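{- The emptiness problem is decidable for one-clock alternating timed automata over finite timed words: there is an algorithm which, given an alternating timed automaton $\mathcal{A}$ with exactly one clock, decides whether $L(\mathcal{A})=\emptyset$.
   Context: Let $\mathbb{R}_+$ be the set of nonnegative reals. For a finite set $\mathcal{C}$ of clocks, the set $\Phi(\mathcal{C})$ of clock constraints is given by $\sigma ::= x<c \mid x\le c \mid \sigma_1\wedge\sigma_2\mid \neg\sigma$, with $x\in\mathcal{C}$ and $c$ a nonnegative integer constant; $[\sigma]\subseteq(\mathbb{R}_+)^{\mathcal{C}}$ is the set of valuations satisfying $\sigma$. $\mathcal{B}^+(X)$ is the set of positive boolean formulas over $X$: $\phi::= x\in X\mid \phi_1\wedge\phi_2\mid\phi_1\vee\phi_2$. $\mathcal{P}$ denotes power set. An alternating timed automaton is a tuple $\mathcal{A}=(Q,q_0,\Sigma,\mathcal{C},F,\delta)$ with $Q$ a finite set of locations, $q_0\in Q$ initial, $\Sigma$ a finite alphabet, $\mathcal{C}$ a finite set of clocks, $F\subseteq Q$ accepting, and $\delta: Q\times\Sigma\times\Phi(\mathcal{C})\rightharpoonup \mathcal{B}^+(Q\times\mathcal{P}(\mathcal{C}))$ a finite partial function satisfying (Partition): for all $q,a$, the sets $[\sigma]$ with $\delta(q,a,\sigma)$ defined form a finite partition of $(\mathbb{R}_+)^{\mathcal{C}}$ (so each valuation satisfies exactly one such $\sigma$). A timed word over $\Sigma$ is a finite sequence $w=(a_1,t_1)\cdots(a_n,t_n)$ in $\Sigma\times\mathbb{R}_+$, where $t_i$ is the time elapsed between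 reading $a_{i-1}$ and $a_i$ ($t_1$: since time $0$). The acceptance game of $\mathcal{A}$ on $w$ is played by Adam and Eve, starting at $(q_0,\mathbf{v}_0)$ with $\mathbf{v}_0$ the all-zero valuation. In phase $k+1$ ($0\le k<n$), from $(q_k,\mathbf{v}_k)$, let $\bar{\mathbf{v}}=\mathbf{v}_k+t_{k+1}$ (every clock increased by $t_{k+1}$), let $\sigma$ be the unique constraint satisfied by $\bar{\mathbf{v}}$ with $b=\delta(q_k,a_{k+1},\sigma)$ defined. While $b=b_1\wedge b_2$, Adam chooses a conjunct to replace $b$; while $b=b_1\vee b_2$, Eve chooses a disjunct; when $b=(q,r)$, the phase ends with $(q_{k+1},\mathbf{v}_{k+1})=(q,\bar{\mathbf{v}}[r:=0])$ (clocks in $r$ reset to $0$). Eve wins iff $q_n\in F$. $\mathcal{A}$ accepts $w$ iff Eve has a winning strategy; $L(\mathcal{A})$ is the set of accepted timed words. One-clock means $|\mathcal{C}|=1$. -}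

module Defs where

open import Data.Bool.Base using (if_then_else_)
open import Data.Fin.Base using (Fin)
open import Data.Fin.Subset using (Subset; _∈_)
open import Data.Fin.Subset.Properties using (_∈?_)
open import Data.Integer.Base using (+_)
open import Data.List.Base using (List; []; _∷_)
import Data.List.Membership.Propositional as List
open import Data.Maybe.Base using (Maybe; just)
open import Data.Nat.Base as ℕ using (ℕ)
import Data.Nat.Properties as ℕ
open import Data.Product using (_×_; _,_; ∃-syntax; Σ-syntax)
open import Data.Rational.Base as ℚ using (ℚ; 0ℚ; ½; ∣_∣)
import Data.Rational.Properties as ℚ
open import Data.Rational.Literals using (fromℤ)
open import Data.Rational.Solver using (module +-*-Solver)
open import Data.Sum.Base using (inj₁; inj₂)
open import Data.Unit.Base using (⊤)
open import Relation.Binary.PropositionalEquality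
  using (_≡_; refl; sym; trans; cong; subst; subst₂)
open import Relation.Nullary using (¬_; does)
open import Relation.Unary using (Pred)
open import Level using (0ℓ)

------------------------------------------------------------------------
-- Real numbers

-- Cauchy sequences of rationals.  They are not quotiented: a real number is
-- represented by any of its sequences, and clock constraints inspect it only
-- through _<_ and _≤_, which do not depend on the choice.

Cauchy : (ℕ → ℚ) → Set
Cauchy x = ∀ ε → 0ℚ ℚ.< ε →
  ∃[ N ] (∀ m n → N ℕ.≤ m → N ℕ.≤ n → ∣ x m ℚ.- x n ∣ ℚ.< ε)

record ℝ : Set where
  constructor mkℝ
  field
    seq    : ℕ → ℚ
    cauchy : Cauchy seq

open ℝ public

infix 4 _<_ _≤_
infixl 6 _+_

_<_ : ℝ → ℝ → Set
x < y = ∃[ ε ] (0ℚ ℚ.< ε × ∃[ N ] (∀ n → N ℕ.≤ n → seq x n ℚ.+ ε ℚ.≤ seq y n))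

_≤_ : ℝ → ℝ → Set
x ≤ y = ¬ (y < x)

private abstract
  halve : ∀ ε → 0ℚ ℚ.< ε → ∃[ h ] (0ℚ ℚ.< h × h ℚ.+ h ≡ ε)
  halve ε ε>0 = ½ ℚ.* ε
    , subst (ℚ._< ½ ℚ.* ε) (ℚ.*-zeroʳ ½) (ℚ.*-monoʳ-<-pos ½ ε>0)
    , trans (sym (ℚ.*-distribʳ-+ ε ½ ½)) (ℚ.*-identityˡ ε)

  <⇒≱ : ∀ {p q} → p ℚ.< q → ¬ (q ℚ.≤ p)
  <⇒≱ p<q q≤p = ℚ.<-irrefl refl (ℚ.<-≤-trans p<q q≤p)

  p≤∣p∣ : ∀ p → p ℚ.≤ ∣ p ∣
  p≤∣p∣ p with ℚ.≤-total 0ℚ p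
  ... | inj₁ 0≤p = ℚ.≤-reflexive (sym (ℚ.0≤p⇒∣p∣≡p 0≤p))
  ... | inj₂ p≤0 = ℚ.≤-trans p≤0 (ℚ.0≤∣p∣ p)

  interchange : ∀ a b c d →
    (a ℚ.- c) ℚ.+ (b ℚ.- d) ≡ (a ℚ.+ b) ℚ.- (c ℚ.+ d)
  interchange = solve 4 (λ a b c d →
      (a :- c) :+ (b :- d) := (a :+ b) :- (c :+ d)) refl
    where open +-*-Solver

  const-cauchy : ∀ q → Cauchy (λ _ → q)
  const-cauchy q ε ε>0 =
    0 , λ _ _ _ _ → subst (ℚ._< ε) (cong ∣_∣ (sym (ℚ.+-inverseʳ q))) ε>0

fromℚ : ℚ → ℝ
fromℚ q = mkℝ (λ _ → q) (const-cauchy q)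

fromℕ : ℕ → ℝ
fromℕ n = fromℚ (fromℤ (+ n))

private abstract
  +-cauchy : ∀ x y → Cauchy (λ n → seq x n ℚ.+ seq y n)
  +-cauchy x y ε ε>0 with h , h>0 , h+h≡ε ← halve ε ε>0
    with M , p ← cauchy x h h>0 | N , q ← cauchy y h h>0 =
    M ℕ.⊔ N , λ m n m≥ n≥ →
    subst₂ ℚ._<_
      (cong ∣_∣ (interchange (seq x m) (seq y m) (seq x n) (seq y n)))
      h+h≡ε
      (ℚ.≤-<-trans
        (ℚ.∣p+q∣≤∣p∣+∣q∣ (seq x m ℚ.- seq x n) (seq y m ℚ.- seq y n))
        (ℚ.+-mono-<
          (p m n (ℕ.m⊔n≤o⇒m≤o M N m≥) (ℕ.m⊔n≤o⇒m≤o M N n≥))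
          (q m n (ℕ.m⊔n≤o⇒n≤o M N m≥) (ℕ.m⊔n≤o⇒n≤o M N n≥))))

_+_ : ℝ → ℝ → ℝ
x + y = mkℝ (λ n → seq x n ℚ.+ seq y n) (+-cauchy x y)

private abstract
  eventually-≥ : ∀ x → fromℕ 0 ≤ x → ∀ ε → 0ℚ ℚ.< ε →
    ∃[ N ] (∀ n → N ℕ.≤ n → ℚ.- ε ℚ.≤ seq x n)
  eventually-≥ x x≥0 ε ε>0 with h , h>0 , refl ← halve ε ε>0
    with N , p ← cauchy x h h>0 =
    N , λ n n≥N → ℚ.≮⇒≥ λ xn<-ε →
    x≥0 (h , h>0 , N , λ m m≥N → ℚ.<⇒≤
      (subst₂ ℚ._<_
        (shift₁ (seq x m) (seq x n) h)
        (shift₂ h)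
        (ℚ.+-monoˡ-< h
          (ℚ.+-mono-<
            (ℚ.≤-<-trans (p≤∣p∣ (seq x m ℚ.- seq x n)) (p m n m≥N n≥N))
            xn<-ε))))
    where
    open +-*-Solver
    shift₁ : ∀ a b h → (a ℚ.- b) ℚ.+ b ℚ.+ h ≡ a ℚ.+ h
    shift₁ = solve 3 (λ a b h → (a :- b) :+ b :+ h := a :+ h) refl
    shift₂ : ∀ h → h ℚ.+ ℚ.- (h ℚ.+ h) ℚ.+ h ≡ 0ℚ
    shift₂ = solve 1 (λ h → h :+ (:- (h :+ h)) :+ h := con 0ℚ) refl

  ≤-refl : ∀ x → x ≤ x
  ≤-refl x (ε , ε>0 , N , p) = <⇒≱ ε>0 (subst₂ ℚ._≤_
    (cancel (seq x N) ε) (ℚ.+-inverseˡ (seq x N))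
    (ℚ.+-monoʳ-≤ (ℚ.- seq x N) (p N ℕ.≤-refl)))
    where
    open +-*-Solver
    cancel : ∀ a e → ℚ.- a ℚ.+ (a ℚ.+ e) ≡ e
    cancel = solve 2 (λ a e → (:- a) :+ (a :+ e) := e) refl

  +-nonneg : ∀ x y → fromℕ 0 ≤ x → fromℕ 0 ≤ y → fromℕ 0 ≤ x + y
  +-nonneg x y x≥0 y≥0 (ε , ε>0 , N , p)
    with g , g>0 , refl ← halve ε ε>0
    with h , h>0 , refl ← halve g g>0
    with K , q ← eventually-≥ x x≥0 h h>0 | L , r ← eventually-≥ y y≥0 h h>0 =
    <⇒≱ g>0 (subst (ℚ._≤ 0ℚ) (cancel h)
      (ℚ.≤-trans
        (ℚ.+-monoˡ-≤ (h ℚ.+ h ℚ.+ (h ℚ.+ h)) (ℚ.+-mono-≤ (q n n≥K) (r n n≥L)))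
        (p n (ℕ.m≤m⊔n N (K ℕ.⊔ L)))))
    where
    open +-*-Solver
    n : ℕ
    n = N ℕ.⊔ (K ℕ.⊔ L)
    n≥K : K ℕ.≤ n
    n≥K = ℕ.≤-trans (ℕ.m≤m⊔n K L) (ℕ.m≤n⊔m N (K ℕ.⊔ L))
    n≥L : L ℕ.≤ n
    n≥L = ℕ.≤-trans (ℕ.m≤n⊔m K L) (ℕ.m≤n⊔m N (K ℕ.⊔ L))
    cancel : ∀ h → (ℚ.- h ℚ.+ ℚ.- h) ℚ.+ (h ℚ.+ h ℚ.+ (h ℚ.+ h)) ≡ h ℚ.+ h
    cancel = solve 1 (λ h →
      ((:- h) :+ (:- h)) :+ (h :+ h :+ (h :+ h)) := h :+ h) refl

record ℝ₊ : Set where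
  constructor mkℝ₊
  field
    real   : ℝ
    nonneg : fromℕ 0 ≤ real

open ℝ₊ public

0₊ : ℝ₊
0₊ = mkℝ₊ (fromℕ 0) (≤-refl (fromℕ 0))

infixl 6 _+₊_

_+₊_ : ℝ₊ → ℝ₊ → ℝ₊
x +₊ y = mkℝ₊ (real x + real y)
  (+-nonneg (real x) (real y) (nonneg x) (nonneg y))

------------------------------------------------------------------------
-- Clock valuations and clock constraints

-- A set of k clocks is Fin k.
Valuation : ℕ → Set
Valuation k = Fin k → ℝ₊

𝟎 : ∀ {k} → Valuation k
𝟎 _ = 0₊

infixl 6 _⊕_

_⊕_ : ∀ {k} → Valuation k → ℝ₊ → Valuation k
(v ⊕ t) x = v x +₊ t

_[_:=0] : ∀ {k} → Valuation k → Subset k → Valuation k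
(v [ r :=0]) x = if does (x ∈? r) then 0₊ else v x

data Φ (k : ℕ) : Set where
  _<ᶜ_ _≤ᶜ_ : Fin k → ℕ → Φ k
  _∧ᶜ_      : Φ k → Φ k → Φ k
  ¬ᶜ_       : Φ k → Φ k

infix 4 _⊨_

_⊨_ : ∀ {k} → Valuation k → Φ k → Set
v ⊨ (x <ᶜ c)  = real (v x) < fromℕ c
v ⊨ (x ≤ᶜ c)  = real (v x) ≤ fromℕ c
v ⊨ (σ ∧ᶜ τ)  = v ⊨ σ × v ⊨ τ
v ⊨ (¬ᶜ σ)    = ¬ (v ⊨ σ)

------------------------------------------------------------------------
-- Alternating timed automata

infixr 6 _∧_
infixr 5 _∨_

data B⁺ (X : Set) : Set where
  atom    : X → B⁺ X
  _∧_ _∨_ : B⁺ X → B⁺ X → B⁺ X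

-- Automata with k clocks.  The partial function δ is finite because its domain
-- of definition is contained in a list.  The constraints on which δ q a is
-- defined cover all valuations in the classical sense, hence the double
-- negation in partition-covers: without it the condition would ask for a method
-- choosing σ from v, and comparing a real with an integer is undecidable, so
-- only degenerate automata would satisfy it.
record ATA (k : ℕ) : Set where
  field
    #Q #Σ : ℕ

  Q : Set
  Q = Fin #Q

  Σ : Set
  Σ = Fin #Σ

  field
    q₀ : Q
    F  : Subset #Q
    δ  : Q → Σ → Φ k → Maybe (B⁺ (Q × Subset k))

  Defined : Q → Σ → Φ k → Set
  Defined q a σ = ∃[ b ] δ q a σ ≡ just b

  field
    support  : List (Q × Σ × Φ k)
    δ-finite : ∀ q a σ → Defined q a σ → (q , a , σ) List.∈ support

    partition-covers   : ∀ q a v → ¬ ¬ (∃[ σ ] (Defined q a σ × v ⊨ σ))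
    partition-disjoint : ∀ q a v σ τ → Defined q a σ → Defined q a τ →
                         v ⊨ σ → v ⊨ τ → σ ≡ τ

  TimedWord : Set
  TimedWord = List (Σ × ℝ₊)

------------------------------------------------------------------------
-- The acceptance game

data Side : Set where
  left right : Side

module Game {k : ℕ} (A : ATA k) where
  open ATA A

  -- In both kinds of position the last argument is the part of the word that
  -- is still to be read.
  data Position : Set where
    phase  : Q → Valuation k → TimedWord → Position
    choice : B⁺ (Q × Subset k) → Valuation k → TimedWord → Position

  infix 4 _⟶_

  -- ∧ˡ and ∧ʳ are moves of Adam, ∨ˡ and ∨ʳ are moves of Eve.  By the partition
  -- condition exactly one σ applies in read, so neither player has a choice.
  data _⟶_ : Position → Position → Set where
    read  : ∀ {q v a t u σ b} → δ q a σ ≡ just b → v ⊕ t ⊨ σ →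
            phase q v ((a , t) ∷ u) ⟶ choice b (v ⊕ t) u
    ∧ˡ    : ∀ {b₁ b₂ v u} → choice (b₁ ∧ b₂) v u ⟶ choice b₁ v u
    ∧ʳ    : ∀ {b₁ b₂ v u} → choice (b₁ ∧ b₂) v u ⟶ choice b₂ v u
    ∨ˡ    : ∀ {b₁ b₂ v u} → choice (b₁ ∨ b₂) v u ⟶ choice b₁ v u
    ∨ʳ    : ∀ {b₁ b₂ v u} → choice (b₁ ∨ b₂) v u ⟶ choice b₂ v u
    reset : ∀ {q r v u} → choice (atom (q , r)) v u ⟶ phase q (v [ r :=0]) u

  infixl 5 _▷_

  data PartialPlay (w : TimedWord) : Position → Set where
    start : PartialPlay w (phase q₀ 𝟎 w)
    _▷_   : ∀ {p p′} → PartialPlay w p → p ⟶ p′ → PartialPlay w p′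

  Strategy : TimedWord → Set
  Strategy w = ∀ {b₁ b₂ v u} → PartialPlay w (choice (b₁ ∨ b₂) v u) → Side

  Follows : ∀ {w} → Strategy w → ∀ {p} → PartialPlay w p → Set
  Follows s start          = ⊤
  Follows s (π ▷ ∨ˡ)       = Follows s π × s π ≡ left
  Follows s (π ▷ ∨ʳ)       = Follows s π × s π ≡ right
  Follows s (π ▷ read _ _) = Follows s π
  Follows s (π ▷ ∧ˡ)       = Follows s π
  Follows s (π ▷ ∧ʳ)       = Follows s π
  Follows s (π ▷ reset)    = Follows s π

  -- Complete plays are those that have consumed the whole word: by the
  -- partition condition a play cannot get stuck earlier.
  Winning : ∀ {w} → Strategy w → Set
  Winning {w} s = ∀ {q v} (π : PartialPlay w (phase q v [])) →
                  Follows s π → q ∈ F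

L : ∀ {k} (A : ATA k) → Pred (ATA.TimedWord A) 0ℓ
L A w = Σ[ s ∈ Game.Strategy A w ] Game.Winning A s

{-# OPTIONS --safe #-}
-- Eve wins on some real word iff she wins on some word whose delays are multiples of
-- some 1/N: replacing the fractional parts of the reading times by their ranks
-- preserves every comparison between a clock value and an integer.
--
-- On such a grid a finite set of states, from all of which Eve has to win on the same
-- remaining word, is described by a word over finite sets of locations with integral
-- parts, ordered by fractional part; integral parts above the maximal constant need
-- not be distinguished.  If Eve wins from a configuration, then she wins from every
-- configuration embedded in it, which has fewer obligations.  By Higman's lemma
-- embedding is a well-quasi-order, so a forward search that ignores configurations
-- above visited ones terminates.

module Submission where

open import Defs
open import Data.Bool.Base using (true; false; if_then_else_)
open import Data.Empty using (⊥; ⊥-elim)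
open import Data.Fin.Base using (Fin; zero; suc)
import Data.Fin.Properties as Fin
open import Data.Fin.Subset using (Subset) renaming (_∈_ to _∈ˢ_)
open import Data.Fin.Subset.Properties using (_∈?_)
open import Data.Integer.Base as ℤ using (+_)
import Data.Integer.Properties as ℤ
open import Data.List.Base as List
  using (List; []; _∷_; [_]; _++_; map; foldr; filter; length; concatMap;
         cartesianProduct; cartesianProductWith; allFin; upTo; initLast; _∷ʳ′_)
open import Data.List.Extrema.Nat using (max; xs≤max)
open import Data.List.Membership.Propositional using (_∈_; lose; find)
open import Data.List.Membership.Propositional.Properties
  using (∈-allFin; ∈-upTo⁺; ∈-cartesianProduct⁺; ∈-cartesianProductWith⁻;
         ∈-concatMap⁺; ∈-concatMap⁻; ∈-map⁺; ∈-++⁺ˡ; ∈-++⁺ʳ; ∈-++⁻)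
import Data.List.Properties as List
open import Data.List.Relation.Binary.Sublist.Heterogeneous
  using (Sublist; []; _∷ʳ_; _∷_; minimum)
open import Data.List.Relation.Binary.Sublist.Heterogeneous.Properties as Sublist
  using (sublist?)
open import Data.List.Relation.Unary.All as All using (All; []; _∷_)
import Data.List.Relation.Unary.All.Properties as All
open import Data.List.Relation.Unary.Any as Any using (Any; here; there; any?)
import Data.List.Relation.Unary.Any.Properties as Any
open import Data.Maybe.Base using (Maybe; just; nothing)
open import Data.Nat.Base as ℕ using (ℕ; zero; suc; z≤n; s≤s)
import Data.Nat.Properties as ℕ
open import Data.Product using (_×_; _,_; proj₁; proj₂; ∃-syntax; ∃₂)
open import Data.Product.Function.NonDependent.Propositional using (_×-⇔_)
import Data.Product.Properties as Product
open import Data.Rational.Base as ℚ using (ℚ; 0ℚ; ½; ∣_∣; *<*; *≤*)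
open import Data.Rational.Literals using (fromℤ)
import Data.Rational.Properties as ℚ
open import Data.Rational.Solver using (module +-*-Solver)
open import Data.Sum.Base using (_⊎_; inj₁; inj₂; [_,_]′)
open import Data.Unit.Base using (⊤; tt)
open import Function.Base using (_∘_; id)
open import Function.Bundles using (_⇔_; mk⇔; Equivalence)
open import Function.Related.TypeIsomorphisms using (¬-cong-⇔)
open import Level using (0ℓ)
open import Relation.Binary.Core using (Rel)
open import Relation.Binary.Definitions
  using (Decidable; Reflexive; Transitive; tri<; tri≈; tri>)
open import Relation.Binary.PropositionalEquality
  using (_≡_; refl; sym; trans; cong; cong₂; subst; subst₂)
open import Relation.Nullary using (¬_; Dec; yes; no; does)
open import Relation.Nullary.Decidable
  using (¬?; _×-dec_; _⊎-dec_; ¬¬-excluded-middle)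
open import Relation.Unary as Unary
  using (Pred; Empty; ∁; _⊆_; _∪_; _∩_; _⟨×⟩_; U)
open Equivalence using (to; from)
open +-*-Solver using (solve; _:=_; _:+_; _:*_; _:-_; :-_; con)

-- Higman's lemma

-- The order of the reals is undecidable, so an accepted real word yields a grid word only under
-- double negation. This suffices for the answer `yes`, since emptiness is itself a negation. The
-- answer `no` rests on a grid word extracted from the search, and dividing its delays by the grid
-- size gives an explicit rational word. The grid size is not part of a configuration: a successful
-- search fixes it at the final configuration, a failed one excludes every size above 1.

private variable
  X Y : Set

-- For decidable _≼_: D contains no infinite sequence x₀, x₁, … such that
-- x_i ⋠ x_j for all i < j.
data Noetherian {X : Set} (_≼_ : Rel X 0ℓ) (D : Pred X 0ℓ) : Set₁ where
  avoiding : (∀ w → D w → Noetherian _≼_ (D ∩ ∁ (w ≼_))) → Noetherian _≼_ D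

module _ {_≼_ : Rel X 0ℓ} where

  noetherian-⊆ : ∀ {D E} → E ⊆ D → Noetherian _≼_ D → Noetherian _≼_ E
  noetherian-⊆ E⊆D (avoiding f) = avoiding λ w e →
    noetherian-⊆ (λ (e′ , w⋠) → E⊆D e′ , w⋠) (f w (E⊆D e))

  noetherian-∅ : Noetherian _≼_ (λ _ → ⊥)
  noetherian-∅ = avoiding λ _ ()

  -- A point of one domain shrinks only that domain; the other is passed on whole, so each recursive
  -- call descends in one argument.
  noetherian-∪ : ∀ {D E} → Noetherian _≼_ D → Noetherian _≼_ E →
                 Noetherian _≼_ (D ∪ E)
  noetherian-∪ (avoiding f) (avoiding g) = avoiding λ
    { w (inj₁ d) → noetherian-⊆
        (λ { (inj₁ d′ , w⋠) → inj₁ (d′ , w⋠) ; (inj₂ e′ , _) → inj₂ e′ })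
        (noetherian-∪ (f w d) (avoiding g))
    ; w (inj₂ e) → noetherian-⊆
        (λ { (inj₁ d′ , _) → inj₁ d′ ; (inj₂ e′ , w⋠) → inj₂ (e′ , w⋠) })
        (noetherian-∪ (avoiding f) (g w e)) }

  noetherian-singleton : Reflexive _≼_ → ∀ x → Noetherian _≼_ (x ≡_)
  noetherian-singleton ≼-refl x = avoiding λ { _ refl →
    noetherian-⊆ (λ { (refl , x⋠x) → x⋠x ≼-refl }) noetherian-∅ }

  noetherian-finite : Reflexive _≼_ → ∀ xs → Noetherian _≼_ (_∈ xs)
  noetherian-finite ≼-refl []       = noetherian-⊆ (λ ()) noetherian-∅
  noetherian-finite ≼-refl (x ∷ xs) = noetherian-⊆
    (λ { (here refl) → inj₁ refl ; (there x∈xs) → inj₂ x∈xs })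
    (noetherian-∪ (noetherian-singleton ≼-refl x) (noetherian-finite ≼-refl xs))

module _ {_≼_ : Rel X 0ℓ} {_≤_ : Rel Y 0ℓ} where

  noetherian-image : (h : X → Y) → (∀ {x x′} → x ≼ x′ → h x ≤ h x′) →
    ∀ {D} → Noetherian _≼_ D → Noetherian _≤_ (λ y → ∃[ x ] (D x × h x ≡ y))
  noetherian-image h mono (avoiding f) = avoiding λ { _ (x , d , refl) →
    noetherian-⊆ (λ { ((x′ , d′ , refl) , ≰) → x′ , (d′ , ≰ ∘ mono) , refl })
      (noetherian-image h mono (f x d)) }

  noetherian-preimage : (h : X → Y) → (∀ {x x′} → h x ≤ h x′ → x ≼ x′) →
    ∀ {D} → Noetherian _≤_ D → Noetherian _≼_ (D ∘ h)
  noetherian-preimage h reflects (avoiding g) = avoiding λ w d →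
    noetherian-⊆ (λ (d′ , w⋠) → d′ , w⋠ ∘ reflects)
      (noetherian-preimage h reflects (g (h w) d))

  infixr 2 _×-≼_

  _×-≼_ : Rel (X × Y) 0ℓ
  (x , y) ×-≼ (x′ , y′) = x ≼ x′ × y ≤ y′

  -- As in Dickson's lemma: a pair not above `(x , y)` fails in the first component or else in the
  -- second. Deciding `x ≼ x′` tells which, and either case leaves a smaller product.
  noetherian-× : Decidable _≼_ → ∀ {D E} →
    Noetherian _≼_ D → Noetherian _≤_ E → Noetherian _×-≼_ (D ⟨×⟩ E)
  noetherian-× _≼?_ {D} {E} (avoiding f) (avoiding g) =
    avoiding λ (x , y) (d , e) →
    noetherian-⊆ (split x y)
      (noetherian-∪ (noetherian-× _≼?_ (f x d) (avoiding g))
                    (noetherian-× _≼?_ (avoiding f) (g y e)))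
    where
    split : ∀ x y → (D ⟨×⟩ E) ∩ ∁ ((x , y) ×-≼_) ⊆
                    ((D ∩ ∁ (x ≼_)) ⟨×⟩ E) ∪ (D ⟨×⟩ (E ∩ ∁ (y ≤_)))
    split x y {x′ , y′} ((d , e) , ⋠) with x ≼? x′
    ... | yes x≼x′ = inj₂ (d , e , λ y≤y′ → ⋠ (x≼x′ , y≤y′))
    ... | no  x⋠x′ = inj₁ ((d , x⋠x′) , e)

-- If a word x does not contain c ∷ w, then either none of its
-- letters dominates c, or x = y ++ d ∷ z where d is the first letter that
-- dominates c and z does not contain w.
module _ {_≼_ : Rel X 0ℓ} (_≼?_ : Decidable _≼_) where

  private
    _⊑_ : Rel (List X) 0ℓ
    _⊑_ = Sublist _≼_

    -- The middle factor is a one-letter word rather than a letter, so that all three factors are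
    -- compared by `_⊑_` and concatenation is monotone in the triple.
    Split : Pred X 0ℓ → X → List X → Pred (List X) 0ℓ
    Split S c w x = ∃[ p ]
      ((All (S ∩ ∁ (c ≼_)) ⟨×⟩
        ((λ u → ∃[ d ] (S d × [ d ] ≡ u)) ⟨×⟩ (All S ∩ ∁ (w ⊑_)))) p
      × (λ (y , d , z) → y ++ d ++ z) p ≡ x)

    split : ∀ {S c w} → All S ∩ ∁ ((c ∷ w) ⊑_) ⊆ All (S ∩ ∁ (c ≼_)) ∪ Split S c w
    split {x = []}    _                = inj₁ []
    split {c = c} {x = d ∷ x} (s ∷ ss , ⋢) with c ≼? d
    ... | yes c≼d = inj₂ ((_ , _ , _) , ([] , (d , s , refl) , ss , λ w⊑x → ⋢ (c≼d ∷ w⊑x)) , refl)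
    ... | no  c⋠d with split (ss , λ cw⊑x → ⋢ (d ∷ʳ cw⊑x))
    ...   | inj₁ ss′ = inj₁ ((s , c⋠d) ∷ ss′)
    ...   | inj₂ ((_ , _ , _) , (ss′ , rest) , refl) =
            inj₂ ((_ , _ , _) , ((s , c⋠d) ∷ ss′ , rest) , refl)

  -- Two nested recursions take the place of a minimal bad sequence: `higman (f c s)` treats words
  -- over the smaller alphabet of letters not above `c`, and `avoid w ss` a shorter forbidden word.
  higman : ∀ {S} → Noetherian _≼_ S → Noetherian _⊑_ (All S)
  higman {S} (avoiding f) = avoiding avoid
    where
    avoid : ∀ w → All S w → Noetherian _⊑_ (All S ∩ ∁ (w ⊑_))
    avoid []      _        = noetherian-⊆ (λ (_ , ⋢) → ⋢ (minimum _)) noetherian-∅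
    avoid (c ∷ w) (s ∷ ss) = noetherian-⊆ split (noetherian-∪
      (higman (f c s))
      (noetherian-image (λ (y , d , z) → y ++ d ++ z)
        (λ (p , q , r) → Sublist.++⁺ p (Sublist.++⁺ q r))
        (noetherian-× (sublist? _≼?_) (higman (f c s))
          (noetherian-× (sublist? _≼?_)
            (noetherian-image [_] (_∷ []) (avoiding f))
            (avoid w ss)))))

-- Forward search modulo a well-quasi-order

module Search {X : Set} {_≼_ : Rel X 0ℓ} (_≼?_ : Decidable _≼_) (≼-refl : Reflexive _≼_)
  {Final : Pred X 0ℓ} (final? : Unary.Decidable Final) (next : X → List X) where

  data Leads : Pred X 0ℓ where
    stop : ∀ {x} → Final x → Leads x
    step : ∀ {x} → Any Leads (next x) → Leads x

  Covered : List X → Pred X 0ℓ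
  Covered ws x = Any (_≼ x) ws

  Stuck : List X → Pred X 0ℓ
  Stuck ws w = ¬ Final w × All (Covered ws) (next w)

  Saturation : List X → List X → Set
  Saturation visited todo = ∃[ ws ]
    ((∀ {v} → v ∈ visited → v ∈ ws) ×
     (∀ {w} → w ∈ ws → w ∈ visited ⊎ Stuck ws w) ×
     All (Covered ws) todo)

  -- The search terminates because it ignores what lies above a visited element.
  explore : ∀ {D} → Noetherian _≼_ D → ∀ visited → ∁ (Covered visited) ⊆ D →
            ∀ todo → Any Leads todo ⊎ Saturation visited todo
  explore D-noeth visited unexplored [] = inj₂ (visited , id , inj₁ , [])
  explore D-noeth visited unexplored (x ∷ todo) with any? (_≼? x) visited
  ... | yes v≼x with explore D-noeth visited unexplored todo
  ...   | inj₁ leads = inj₁ (there leads)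
  ...   | inj₂ (ws , incl , stuck , cov) =
          let _ , v∈ , v≼ = find v≼x in
          inj₂ (ws , incl , stuck , lose (incl v∈) v≼ ∷ cov)
  explore (avoiding f) visited unexplored (x ∷ todo) | no v⋠x with final? x
  ...   | yes fx = inj₁ (here (stop fx))
  ...   | no ¬fx with explore (f x (unexplored v⋠x)) (x ∷ visited)
                        (λ y⋡ → unexplored (y⋡ ∘ there) , y⋡ ∘ here) (next x ++ todo)
  ...     | inj₁ leads with Any.++⁻ (next x) leads
  ...       | inj₁ l = inj₁ (here (step l))
  ...       | inj₂ l = inj₁ (there l)
  explore (avoiding f) visited unexplored (x ∷ todo) | no v⋠x | no ¬fx
          | inj₂ (ws , incl , stuck , cov) =
    inj₂ (ws , incl ∘ there , stuck′ , lose (incl (here refl)) ≼-refl ∷ All.++⁻ʳ (next x) cov)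
    where
    stuck′ : ∀ {w} → w ∈ ws → w ∈ visited ⊎ Stuck ws w
    stuck′ w∈ with stuck w∈
    ... | inj₁ (here refl) = inj₂ (¬fx , All.++⁻ˡ (next x) cov)
    ... | inj₁ (there w∈v) = inj₁ w∈v
    ... | inj₂ s           = inj₂ s

  search : Noetherian _≼_ U → ∀ x → Leads x ⊎
           ∃[ ws ] (Covered ws x × (∀ {w} → w ∈ ws → Stuck ws w))
  search noeth x with explore noeth [] (λ _ → tt) [ x ]
  ... | inj₁ (here l) = inj₁ l
  ... | inj₂ (ws , _ , stuck , c ∷ []) = inj₂ (ws , c , λ w∈ → [ (λ ()) , id ]′ (stuck w∈))

-- The acceptance game

-- The game is abstracted from the representation of time, so that real and grid plays are instances
-- of one definition and can be related by simulations.
record ClockModel (k : ℕ) : Set₁ where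
  field
    Value Delay : Set
    elapse      : Value → Delay → Value
    resetValue  : Value → Subset k → Value
    _⊩_         : Value → Φ k → Set

module EveWins {k} (A : ATA k) (𝓜 : ClockModel k) where
  open ATA A
  open ClockModel 𝓜

  -- Like Winning, Wins asks nothing of a play that is stuck because no constraint
  -- applies.
  mutual
    Wins : List (Σ × Delay) → Q → Value → Set
    Wins []            q v = q ∈ˢ F
    Wins ((a , t) ∷ u) q v = ∀ {σ b} → δ q a σ ≡ just b → elapse v t ⊩ σ →
                             WinsChoice u b (elapse v t)

    WinsChoice : List (Σ × Delay) → B⁺ (Q × Subset k) → Value → Set
    WinsChoice u (atom (q , r)) v = Wins u q (resetValue v r)
    WinsChoice u (b₁ ∧ b₂)      v = WinsChoice u b₁ v × WinsChoice u b₂ v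
    WinsChoice u (b₁ ∨ b₂)      v = WinsChoice u b₁ v ⊎ WinsChoice u b₂ v

realModel : ∀ k → ClockModel k
realModel k = record
  { Value = Valuation k ; Delay = ℝ₊ ; elapse = _⊕_ ; resetValue = _[_:=0] ; _⊩_ = _⊨_ }

module _ {k} (A : ATA k) where
  open ATA A
  open Game A
  open EveWins A (realModel k)

  module _ {w} (s : Strategy w) (winning : Winning s) where

    mutual
      strategy⇒wins : ∀ {u q v} (π : PartialPlay w (phase q v u)) → Follows s π → Wins u q v
      strategy⇒wins {[]}    π f     = winning π f
      strategy⇒wins {_ ∷ _} π f d σ = strategy⇒winsChoice _ (π ▷ read d σ) f

      strategy⇒winsChoice : ∀ {u v} b (π : PartialPlay w (choice b v u)) →
                            Follows s π → WinsChoice u b v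
      strategy⇒winsChoice (atom _)  π f = strategy⇒wins (π ▷ reset) f
      strategy⇒winsChoice (b₁ ∧ b₂) π f =
        strategy⇒winsChoice b₁ (π ▷ ∧ˡ) f , strategy⇒winsChoice b₂ (π ▷ ∧ʳ) f
      strategy⇒winsChoice (b₁ ∨ b₂) π f with s π in eq
      ... | left  = inj₁ (strategy⇒winsChoice b₁ (π ▷ ∨ˡ) (f , eq))
      ... | right = inj₂ (strategy⇒winsChoice b₂ (π ▷ ∨ʳ) (f , eq))

  module _ {w} (wins : Wins w q₀ 𝟎) where

    private
      WinsAt : Position → Set
      WinsAt (phase q v u)  = Wins u q v
      WinsAt (choice b v u) = WinsChoice u b v

      -- nothing means that Eve has already deviated from the strategy below.
      track : ∀ {p} → PartialPlay w p → Maybe (WinsAt p)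
      track start          = just wins
      track (π ▷ read d σ) with track π
      ... | just h  = just (h d σ)
      ... | nothing = nothing
      track (π ▷ ∧ˡ) with track π
      ... | just (h , _) = just h
      ... | nothing      = nothing
      track (π ▷ ∧ʳ) with track π
      ... | just (_ , h) = just h
      ... | nothing      = nothing
      track (π ▷ ∨ˡ) with track π
      ... | just (inj₁ h) = just h
      ... | _             = nothing
      track (π ▷ ∨ʳ) with track π
      ... | just (inj₂ h) = just h
      ... | _             = nothing
      track (π ▷ reset) with track π
      ... | just h  = just h
      ... | nothing = nothing

    -- `track` carries a proof that Eve still wins along the play, and at a disjunction this proof
    -- names the disjunct. The default `left` concerns only plays that have left the strategy.
    winningStrategy : Strategy w
    winningStrategy π with track π
    ... | just (inj₁ _) = left
    ... | just (inj₂ _) = right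
    ... | nothing       = left

    private
      tracked : ∀ {p} (π : PartialPlay w p) → Follows winningStrategy π →
                ∃[ h ] track π ≡ just h
      tracked start          f = _ , refl
      tracked (π ▷ read d σ) f with track π | tracked π f
      ... | _ | _ , refl = _ , refl
      tracked (π ▷ ∧ˡ) f with track π | tracked π f
      ... | _ | _ , refl = _ , refl
      tracked (π ▷ ∧ʳ) f with track π | tracked π f
      ... | _ | _ , refl = _ , refl
      tracked (π ▷ ∨ˡ) (f , eq) with track π | tracked π f | eq
      ... | just (inj₁ _) | _ | _ = _ , refl
      tracked (π ▷ ∨ʳ) (f , eq) with track π | tracked π f | eq
      ... | just (inj₂ _) | _ | _ = _ , refl
      tracked (π ▷ reset) f with track π | tracked π f
      ... | _ | _ , refl = _ , refl

    winningStrategy-winning : Winning winningStrategy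
    winningStrategy-winning π f = proj₁ (tracked π f)

  L⇒wins : ∀ {w} → L A w → Wins w q₀ 𝟎
  L⇒wins (s , winning) = strategy⇒wins s winning start tt

  wins⇒L : ∀ {w} → Wins w q₀ 𝟎 → L A w
  wins⇒L wins = winningStrategy wins , winningStrategy-winning wins

-- Simulations between clock models

module _ {k} (A : ATA k) (𝓜₁ 𝓜₂ : ClockModel k) where
  open ATA A
  private
    module 𝓜₁ = ClockModel 𝓜₁
    module 𝓜₂ = ClockModel 𝓜₂
    module W₁ = EveWins A 𝓜₁
    module W₂ = EveWins A 𝓜₂
    Word₁ = List (Σ × 𝓜₁.Delay)
    Word₂ = List (Σ × 𝓜₂.Delay)

  module _ (_⊢_≲_⊣_ : Word₁ → 𝓜₁.Value → 𝓜₂.Value → Word₂ → Set) where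

    -- Constraints are transported backwards, from the second model to the first: `Wins` is
    -- universal over enabled transitions, so one enabled on the right must be answered by the win
    -- on the left.
    Advances : Word₁ → 𝓜₁.Value → 𝓜₂.Value → Word₂ → Set
    Advances []             v₁ v₂ []              = ⊤
    Advances []             v₁ v₂ (_ ∷ _)         = ⊥
    Advances (_ ∷ _)        v₁ v₂ []              = ⊥
    Advances ((a , t) ∷ u₁) v₁ v₂ ((b , t′) ∷ u₂) =
      let v₁′ = 𝓜₁.elapse v₁ t ; v₂′ = 𝓜₂.elapse v₂ t′ in
      a ≡ b ×
      (∀ {q σ} → Defined q a σ → v₂′ 𝓜₂.⊩ σ → v₁′ 𝓜₁.⊩ σ) ×
      u₁ ⊢ v₁′ ≲ v₂′ ⊣ u₂

  module Simulation
    (_⊢_≲_⊣_ : Word₁ → 𝓜₁.Value → 𝓜₂.Value → Word₂ → Set)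
    (advance : ∀ {u₁ v₁ v₂ u₂} → u₁ ⊢ v₁ ≲ v₂ ⊣ u₂ → Advances _⊢_≲_⊣_ u₁ v₁ v₂ u₂)
    (resets  : ∀ {u₁ v₁ v₂ u₂} → u₁ ⊢ v₁ ≲ v₂ ⊣ u₂ →
               ∀ r → u₁ ⊢ 𝓜₁.resetValue v₁ r ≲ 𝓜₂.resetValue v₂ r ⊣ u₂)
    where

    mutual
      simulate : ∀ {u₁ v₁ v₂ u₂ q} → u₁ ⊢ v₁ ≲ v₂ ⊣ u₂ → W₁.Wins u₁ q v₁ → W₂.Wins u₂ q v₂
      simulate {[]}    {u₂ = []}    s wins     = wins
      simulate {[]}    {u₂ = _ ∷ _} s wins     = ⊥-elim (advance s)
      simulate {_ ∷ _} {u₂ = []}    s wins     = ⊥-elim (advance s)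
      simulate {_ ∷ _} {u₂ = _ ∷ _} s wins {b = b} d σ with refl , agree , s′ ← advance s =
        simulateChoice b s′ (wins d (agree (_ , d) σ))

      simulateChoice : ∀ {u₁ v₁ v₂ u₂} b → u₁ ⊢ v₁ ≲ v₂ ⊣ u₂ →
                       W₁.WinsChoice u₁ b v₁ → W₂.WinsChoice u₂ b v₂
      simulateChoice (atom (_ , r)) s wins          = simulate (resets s r) wins
      simulateChoice (b₁ ∧ b₂)      s (wins₁ , wins₂) =
        simulateChoice b₁ s wins₁ , simulateChoice b₂ s wins₂
      simulateChoice (b₁ ∨ b₂)      s (inj₁ wins₁)  = inj₁ (simulateChoice b₁ s wins₁)
      simulateChoice (b₁ ∨ b₂)      s (inj₂ wins₂)  = inj₂ (simulateChoice b₂ s wins₂)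

-- Clock readings on the grid and in regions

-- What a clock constraint can see of the value of the single clock.
record Reading : Set₁ where
  field
    under over : ℕ → Set

open Reading

infix 4 _⊩ʳ_

_⊩ʳ_ : Reading → Φ 1 → Set
ρ ⊩ʳ (_ <ᶜ c) = under ρ c
ρ ⊩ʳ (_ ≤ᶜ c) = ¬ over ρ c
ρ ⊩ʳ (σ ∧ᶜ τ) = ρ ⊩ʳ σ × ρ ⊩ʳ τ
ρ ⊩ʳ (¬ᶜ σ)   = ¬ (ρ ⊩ʳ σ)

⊩ʳ? : ∀ {ρ} → Unary.Decidable (under ρ) → Unary.Decidable (over ρ) →
      Unary.Decidable (ρ ⊩ʳ_)
⊩ʳ? b? a? (_ <ᶜ c) = b? c
⊩ʳ? b? a? (_ ≤ᶜ c) = ¬? (a? c)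
⊩ʳ? b? a? (σ ∧ᶜ τ) = ⊩ʳ? b? a? σ ×-dec ⊩ʳ? b? a? τ
⊩ʳ? b? a? (¬ᶜ σ)   = ¬? (⊩ʳ? b? a? σ)

bound : Φ 1 → ℕ
bound (_ <ᶜ c) = c
bound (_ ≤ᶜ c) = c
bound (σ ∧ᶜ τ) = bound σ ℕ.⊔ bound τ
bound (¬ᶜ σ)   = bound σ

Agree : ℕ → Reading → Reading → Set
Agree m ρ ρ′ = ∀ {c} → c ℕ.≤ m → (under ρ c ⇔ under ρ′ c) × (over ρ c ⇔ over ρ′ c)

⊩ʳ-cong : ∀ {m ρ ρ′} → Agree m ρ ρ′ → ∀ σ → bound σ ℕ.≤ m → (ρ ⊩ʳ σ) ⇔ (ρ′ ⊩ʳ σ)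
⊩ʳ-cong agree (_ <ᶜ c) ≤m = proj₁ (agree ≤m)
⊩ʳ-cong agree (_ ≤ᶜ c) ≤m = ¬-cong-⇔ (proj₂ (agree ≤m))
⊩ʳ-cong agree (σ ∧ᶜ τ) ≤m =
  ⊩ʳ-cong agree σ (ℕ.m⊔n≤o⇒m≤o (bound σ) (bound τ) ≤m) ×-⇔
  ⊩ʳ-cong agree τ (ℕ.m⊔n≤o⇒n≤o (bound σ) (bound τ) ≤m)
⊩ʳ-cong agree (¬ᶜ σ)   ≤m = ¬-cong-⇔ (⊩ʳ-cong agree σ ≤m)

-- On the grid, time is measured in multiples of 1/N.
gridReading : ℕ → ℕ → Reading
gridReading N n = record { under = λ c → n ℕ.< c ℕ.* N ; over = λ c → c ℕ.* N ℕ.< n }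

gridModel : ℕ → ClockModel 1
gridModel N = record
  { Value      = ℕ
  ; Delay      = ℕ
  ; elapse     = λ n t → t ℕ.+ n
  ; resetValue = λ n r → if does (zero ∈? r) then 0 else n
  ; _⊩_        = λ n → gridReading N n ⊩ʳ_
  }

-- The reading of i + x for a fractional part x that vanishes iff z does.
regionReading : ℕ → ℕ → Reading
regionReading z i = record
  { under = i ℕ.<_ ; over = λ c → c ℕ.< i ⊎ (c ≡ i × 0 ℕ.< z) }

Lex : ℕ → ℕ → ℕ → ℕ → Set
Lex r i r′ j = i ℕ.< j ⊎ (i ≡ j × r ℕ.< r′)

digits-< : ∀ {N r r′ i j} → r ℕ.< N → i ℕ.< j → r ℕ.+ i ℕ.* N ℕ.< r′ ℕ.+ j ℕ.* N
digits-< {N} {r} {r′} {i} {j} r<N i<j = ℕ.<-≤-trans (ℕ.+-monoˡ-< (i ℕ.* N) r<N)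
  (ℕ.≤-trans (ℕ.*-monoˡ-≤ N i<j) (ℕ.m≤n+m (j ℕ.* N) r′))

digits-lex : ∀ {N r r′ i j} → r ℕ.< N → r′ ℕ.< N →
  (r ℕ.+ i ℕ.* N ℕ.< r′ ℕ.+ j ℕ.* N) ⇔ Lex r i r′ j
digits-lex {N} {r} {r′} {i} {j} r<N r′<N = mk⇔ forth back
  where
  forth : r ℕ.+ i ℕ.* N ℕ.< r′ ℕ.+ j ℕ.* N → Lex r i r′ j
  forth lt with ℕ.<-cmp i j
  ... | tri< i<j _ _  = inj₁ i<j
  ... | tri≈ _ refl _ = inj₂ (refl , ℕ.+-cancelʳ-< (i ℕ.* N) r r′ lt)
  ... | tri> _ _ j<i  = ⊥-elim (ℕ.<-asym lt (digits-< r′<N j<i))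
  back : Lex r i r′ j → r ℕ.+ i ℕ.* N ℕ.< r′ ℕ.+ j ℕ.* N
  back (inj₁ i<j)           = digits-< r<N i<j
  back (inj₂ (refl , r<r′)) = ℕ.+-monoˡ-< (i ℕ.* N) r<r′

-- A constant `c` is the two-digit number `0 + c * N`. Lexicographic comparison with it sees the
-- integral part `i` and, when `c` equals `i`, only whether the low digit is positive.
grid-region : ∀ {N r z i m} → r ℕ.< N → (0 ℕ.< r ⇔ 0 ℕ.< z) →
  Agree m (gridReading N (r ℕ.+ i ℕ.* N)) (regionReading z i)
grid-region {N} {r} {z} {i} r<N r⇔z {c} _ =
  mk⇔ (λ lt → strip (to (digits-lex r<N 0<N) lt))
      (λ i<c → from (digits-lex {r′ = 0} r<N 0<N) (inj₁ i<c)) ,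
  mk⇔ (λ lt → weaken (to r⇔z) (to (digits-lex 0<N r<N) lt))
      (λ lt → from (digits-lex 0<N r<N) (weaken (from r⇔z) lt))
  where
  0<N : 0 ℕ.< N
  0<N = ℕ.≤-<-trans z≤n r<N
  strip : Lex r i 0 c → i ℕ.< c
  strip (inj₁ i<c) = i<c
  weaken : ∀ {y z} → (0 ℕ.< y → 0 ℕ.< z) → Lex 0 c y i → Lex 0 c z i
  weaken f (inj₁ lt)        = inj₁ lt
  weaken f (inj₂ (eq , lt)) = inj₂ (eq , f lt)

-- Configurations over discrete time

module OneClock (A : ATA 1) where
  open ATA A

  GridWord : Set
  GridWord = List (Σ × ℕ)

  Wins : ℕ → GridWord → Q → ℕ → Set
  Wins N = EveWins.Wins A (gridModel N)

  WinsChoice : ℕ → GridWord → B⁺ (Q × Subset 1) → ℕ → Set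
  WinsChoice N = EveWins.WinsChoice A (gridModel N)

  maxConstant : ℕ
  maxConstant = max 0 (map (λ (_ , _ , σ) → bound σ) support)

  bound-defined : ∀ {q a σ} → Defined q a σ → bound σ ℕ.≤ maxConstant
  bound-defined d = All.lookup (xs≤max 0 _) (∈-map⁺ _ (δ-finite _ _ _ d))

  -- A location together with the integral part of the clock.
  Elt : Set
  Elt = Q × ℕ

  -- Eve wins from a clock value with fractional part r/N.
  Won : ℕ → GridWord → ℕ → Pred Elt 0ℓ
  Won N u r (q , i) = Wins N u q (r ℕ.+ i ℕ.* N)

  shift : ℕ → GridWord → GridWord
  shift d []            = []
  shift d ((a , t) ∷ u) = (a , d ℕ.+ t) ∷ u

  wins-shift : ∀ {N d q v} u → Wins N (shift d u) q v ⇔ Wins N u q (d ℕ.+ v)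
  wins-shift []            = mk⇔ id id
  wins-shift {N} {d} {q} {v} ((a , t) ∷ u) =
    mk⇔ (subst P eq) (subst P (sym eq))
    where
    P : ℕ → Set
    P v′ = ∀ {σ b} → δ q a σ ≡ just b → gridReading N v′ ⊩ʳ σ → WinsChoice N u b v′
    eq : d ℕ.+ t ℕ.+ v ≡ t ℕ.+ (d ℕ.+ v)
    eq = trans (cong (ℕ._+ v) (ℕ.+-comm d t)) (ℕ.+-assoc t d v)

  won-shift : ∀ {N d r} u x → Won N (shift d u) r x ⇔ Won N u (r ℕ.+ d) x
  won-shift {N} {d} {r} u (q , i) =
    subst (λ v → Wins N (shift d u) q (r ℕ.+ i ℕ.* N) ⇔ Wins N u q v) eq (wins-shift u)
    where
    eq : d ℕ.+ (r ℕ.+ i ℕ.* N) ≡ r ℕ.+ d ℕ.+ i ℕ.* N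
    eq = trans (sym (ℕ.+-assoc d r _)) (cong (ℕ._+ i ℕ.* N) (ℕ.+-comm d r))

  next-integer : Elt → Elt
  next-integer (q , i) = q , suc i

  won-wrap : ∀ {N d r} → r ℕ.+ d ≡ N → ∀ u x →
             Won N (shift d u) r x ⇔ Won N u 0 (next-integer x)
  -- Once `N` is `r + d`, the value `suc i * N` unfolds to `r + d + i * N`.
  won-wrap {r = r} refl u x = won-shift {r = r} u x

  private
    -- `suc maxConstant` represents all larger integral parts. `maxConstant` itself stays apart:
    -- with fractional part 0 it still satisfies `≤ᶜ maxConstant`.
    key : Elt → Elt
    key (q , i) = q , i ℕ.⊓ suc maxConstant

  infix 4 _~_

  -- Integral parts above the maximal constant are not distinguished.
  _~_ : Rel Elt 0ℓ
  x ~ y = key x ≡ key y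

  _~?_ : Decidable _~_
  x ~? y = Product.≡-dec Fin._≟_ ℕ._≟_ (key x) (key y)

  ~-noetherian : Noetherian _~_ U
  ~-noetherian = noetherian-⊆ (λ {x} _ → key∈ x)
    (noetherian-preimage {_≤_ = _≡_} key id
      (noetherian-finite refl (cartesianProduct (allFin #Q) (upTo (2 ℕ.+ maxConstant)))))
    where
    key∈ : ∀ x → key x ∈ cartesianProduct (allFin #Q) (upTo (2 ℕ.+ maxConstant))
    key∈ (q , i) = ∈-cartesianProduct⁺ (∈-allFin q) (∈-upTo⁺ (s≤s (ℕ.m⊓n≤n i _)))

  private
    -- An invariant of play: values above every constant stay there as time passes, and a reset
    -- makes both values equal.
    Similar : ℕ → ℕ → ℕ → Set
    Similar N v v′ = v ≡ v′ ⊎ (maxConstant ℕ.* N ℕ.< v × maxConstant ℕ.* N ℕ.< v′)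

    similar-agree : ∀ {N v v′} → Similar N v v′ →
                    Agree maxConstant (gridReading N v) (gridReading N v′)
    similar-agree (inj₁ refl) _ = mk⇔ id id , mk⇔ id id
    similar-agree {N} {v} {v′} (inj₂ (large , large′)) {c} c≤M =
      mk⇔ (λ lt → ⊥-elim (ℕ.<-asym lt (above′ large)))
          (λ lt → ⊥-elim (ℕ.<-asym lt (above′ large′))) ,
      mk⇔ (λ _ → above′ large′) (λ _ → above′ large)
      where
      above′ : ∀ {v} → maxConstant ℕ.* N ℕ.< v → c ℕ.* N ℕ.< v
      above′ = ℕ.≤-<-trans (ℕ.*-monoˡ-≤ N c≤M)

    similar-+ : ∀ {N v v′} t → Similar N v v′ → Similar N (t ℕ.+ v) (t ℕ.+ v′)
    similar-+ t (inj₁ refl)             = inj₁ refl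
    similar-+ t (inj₂ (large , large′)) =
      inj₂ (ℕ.<-≤-trans large (ℕ.m≤n+m _ t) , ℕ.<-≤-trans large′ (ℕ.m≤n+m _ t))

  wins-similar : ∀ {N u q v v′} → Similar N v v′ → Wins N u q v → Wins N u q v′
  wins-similar {N} sim = simulate (refl , sim)
    where
    R : GridWord → ℕ → ℕ → GridWord → Set
    R u v v′ u′ = u ≡ u′ × Similar N v v′
    advance : ∀ {u v v′ u′} → R u v v′ u′ → Advances A (gridModel N) (gridModel N) R u v v′ u′
    advance {[]}          (refl , _) = tt
    advance {(a , t) ∷ u} (refl , s) = refl ,
      (λ {_} {σ} d → from (⊩ʳ-cong (similar-agree (similar-+ t s)) σ (bound-defined d))) ,
      refl , similar-+ t s
    resets : ∀ {u v v′ u′} → R u v v′ u′ → ∀ r →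
      R u (ClockModel.resetValue (gridModel N) v r) (ClockModel.resetValue (gridModel N) v′ r) u′
    resets (refl , s) r with does (zero ∈? r)
    ... | true  = refl , inj₁ refl
    ... | false = refl , s
    open Simulation A (gridModel N) (gridModel N) R advance resets

  won-resp-~ : ∀ {N u r x y} → r ℕ.< N → x ~ y → Won N u r x → Won N u r y
  won-resp-~ {N} {u} {r} {q , i} {q′ , j} r<N x~y with refl , eq ← Product.,-injective x~y =
    wins-similar (similar eq)
    where
    M = maxConstant
    large : ∀ {i} → M ℕ.< i → M ℕ.* N ℕ.< r ℕ.+ i ℕ.* N
    large = digits-< (ℕ.≤-<-trans z≤n r<N)
    small : ∀ {i} → i ℕ.≤ M → i ℕ.⊓ suc M ≡ i
    small i≤M = ℕ.m≤n⇒m⊓n≡m (ℕ.m≤n⇒m≤1+n i≤M)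
    similar : i ℕ.⊓ suc M ≡ j ℕ.⊓ suc M → Similar N (r ℕ.+ i ℕ.* N) (r ℕ.+ j ℕ.* N)
    similar eq with i ℕ.≤? M | j ℕ.≤? M
    ... | yes i≤M | yes j≤M = inj₁ (cong (λ k → r ℕ.+ k ℕ.* N)
            (trans (sym (small i≤M)) (trans eq (small j≤M))))
    ... | yes i≤M | no  j≰M = ⊥-elim (ℕ.<-irrefl
            (trans (sym (small i≤M)) (trans eq (ℕ.m≥n⇒m⊓n≡n (ℕ.≰⇒> j≰M)))) (s≤s i≤M))
    ... | no  i≰M | yes j≤M = ⊥-elim (ℕ.<-irrefl
            (trans (sym (small j≤M)) (trans (sym eq) (ℕ.m≥n⇒m⊓n≡n (ℕ.≰⇒> i≰M)))) (s≤s j≤M))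
    ... | no  i≰M | no  j≰M = inj₂ (large (ℕ.≰⇒> i≰M) , large (ℕ.≰⇒> j≰M))

-- Embedding of configurations and their discrete successors

module Configs (A : ATA 1) where
  open ATA A
  open OneClock A

  Letter : Set
  Letter = List Elt

  -- Letters list the elements of a configuration by increasing fractional part;
  -- the first component holds those with fractional part 0.
  Config : Set
  Config = Letter × List Letter

  -- A configuration fixes only the order of the fractional parts, so their digits are chosen
  -- existentially. Gaps between them are allowed, hence letters can be deleted without moving the
  -- others.
  data Placed (P : ℕ → Pred Elt 0ℓ) (N : ℕ) : ℕ → Pred (List Letter) 0ℓ where
    []    : ∀ {s} → Placed P N s []
    place : ∀ {s L W} r → s ℕ.≤ r → r ℕ.< N → All (P r) L →
            Placed P N (suc r) W → Placed P N s (L ∷ W)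

  Fits : ℕ → GridWord → Pred Config 0ℓ
  Fits N u (L , W) = All (Won N u 0) L × Placed (Won N u) N 1 W

  placed-weaken : ∀ {P N s s′ W} → s ℕ.≤ s′ → Placed P N s′ W → Placed P N s W
  placed-weaken s≤s′ []                         = []
  placed-weaken s≤s′ (place r s′≤r r<N ps rest) = place r (ℕ.≤-trans s≤s′ s′≤r) r<N ps rest

  infix 4 _⊑_ _≼_

  _⊑_ : Rel Letter 0ℓ
  _⊑_ = Sublist _~_

  _⊑?_ : Decidable _⊑_
  _⊑?_ = sublist? _~?_

  _≼_ : Rel Config 0ℓ
  _≼_ = _×-≼_ {_≼_ = _⊑_} {_≤_ = Sublist _⊑_}

  _≼?_ : Decidable _≼_
  (L , W) ≼? (L′ , W′) = (L ⊑? L′) ×-dec sublist? _⊑?_ W W′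

  private
    sublist-refl : ∀ {X : Set} {_≤_ : Rel X 0ℓ} → Reflexive _≤_ → Reflexive (Sublist _≤_)
    sublist-refl ≤-refl {[]}    = []
    sublist-refl ≤-refl {_ ∷ _} = ≤-refl ∷ sublist-refl ≤-refl

    all-U : ∀ {X : Set} (xs : List X) → All U xs
    all-U = All.universal (λ _ → tt)

  ≼-refl : Reflexive _≼_
  ≼-refl = sublist-refl refl , sublist-refl (sublist-refl refl)

  ≼-noetherian : Noetherian _≼_ U
  ≼-noetherian = noetherian-⊆
    (λ { {L , W} _ → all-U L , All.universal all-U W })
    (noetherian-× _⊑?_ letters (higman _⊑?_ letters))
    where
    letters : Noetherian _⊑_ (All U)
    letters = higman _~?_ ~-noetherian

  letter-antitone : ∀ {N u r} → r ℕ.< N → ∀ {L L′} → L ⊑ L′ →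
                    All (Won N u r) L′ → All (Won N u r) L
  letter-antitone r<N []       []       = []
  letter-antitone r<N (_ ∷ʳ s) (_ ∷ ws) = letter-antitone r<N s ws
  letter-antitone r<N {x ∷ _} {y ∷ _} (x~y ∷ s) (w ∷ ws) =
    won-resp-~ {x = y} {y = x} r<N (sym x~y) w ∷ letter-antitone r<N s ws

  placed-antitone : ∀ {N u s W W′} → Sublist _⊑_ W W′ →
                    Placed (Won N u) N s W′ → Placed (Won N u) N s W
  placed-antitone []         []                        = []
  placed-antitone (_ ∷ʳ sub) (place r s≤r r<N _ rest)  =
    placed-weaken (ℕ.m≤n⇒m≤1+n s≤r) (placed-antitone sub rest)
  placed-antitone (l ∷ sub)  (place r s≤r r<N ws rest) =
    place r s≤r r<N (letter-antitone r<N l ws) (placed-antitone sub rest)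

  fits-antitone : ∀ {N u C C′} → 0 ℕ.< N → C ≼ C′ → Fits N u C′ → Fits N u C
  fits-antitone 0<N (l , sub) (ws , pl) = letter-antitone 0<N l ws , placed-antitone sub pl

  -- The elements reset to 0 and those that keep the value of the clock.
  Outcome : Set
  Outcome = List Elt × List Elt

  _∙_ : Outcome → Outcome → Outcome
  (R , S) ∙ (R′ , S′) = R ++ R′ , S ++ S′

  Good : ℕ → GridWord → ℕ → Pred Outcome 0ℓ
  Good N u r (R , S) = All (Won N u 0) R × All (Won N u r) S

  private
    good-∙⁺ : ∀ {N u r o p} → Good N u r o → Good N u r p → Good N u r (o ∙ p)
    good-∙⁺ (w , x) (y , z) = All.++⁺ w y , All.++⁺ x z

    good-∙⁻ : ∀ {N u r o p} → Good N u r (o ∙ p) → Good N u r o × Good N u r p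
    good-∙⁻ {o = R , S} (w , x) =
      (All.++⁻ˡ R w , All.++⁻ˡ S x) , (All.++⁻ʳ R w , All.++⁻ʳ S x)

  combine : List (List Outcome) → List Outcome
  combine = foldr (cartesianProductWith _∙_) [ ([] , []) ]

  combine-good : ∀ {N u r} oss → Any (Good N u r) (combine oss) ⇔ All (Any (Good N u r)) oss
  combine-good []         = mk⇔ (λ _ → []) (λ _ → here ([] , []))
  combine-good {N} {u} {r} (os ∷ oss) = mk⇔
    (λ g → let x , y = Any.cartesianProductWith⁻ _∙_ (λ {o} → good-∙⁻ {N} {u} {r} {o})
                       os (combine oss) g in
           x ∷ to (combine-good oss) y)
    (λ { (x ∷ xs) → Any.cartesianProductWith⁺ _∙_ (good-∙⁺ {N} {u} {r})
                       x (from (combine-good oss) xs) })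

  -- A disjunctive normal form: Eve's choices are enumerated as the list, and each outcome collects
  -- all the obligations that Adam may pick from.
  resolve : ℕ → B⁺ (Q × Subset 1) → List Outcome
  resolve i (atom (q , r)) = [ (if does (zero ∈? r) then ([ q , 0 ] , []) else ([] , [ q , i ])) ]
  resolve i (b₁ ∧ b₂)      = cartesianProductWith _∙_ (resolve i b₁) (resolve i b₂)
  resolve i (b₁ ∨ b₂)      = resolve i b₁ ++ resolve i b₂

  resolve-good : ∀ {N u r i} b →
    Any (Good N u r) (resolve i b) ⇔ WinsChoice N u b (r ℕ.+ i ℕ.* N)
  resolve-good (atom (q , r)) with does (zero ∈? r)
  ... | true  = mk⇔ (λ { (here (w ∷ [] , [])) → w }) (λ w → here (w ∷ [] , []))
  ... | false = mk⇔ (λ { (here ([] , w ∷ [])) → w }) (λ w → here ([] , w ∷ []))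
  resolve-good {N} {u} {r} {i} (b₁ ∧ b₂) = mk⇔
    (λ g → let x , y = Any.cartesianProductWith⁻ _∙_ (λ {o} → good-∙⁻ {N} {u} {r} {o})
                       (resolve i b₁) (resolve i b₂) g in
           to (resolve-good b₁) x , to (resolve-good b₂) y)
    (λ (x , y) → Any.cartesianProductWith⁺ _∙_ (good-∙⁺ {N} {u} {r})
                   (from (resolve-good b₁) x) (from (resolve-good b₂) y))
  resolve-good {i = i} (b₁ ∨ b₂) = mk⇔
    (λ g → split (Any.++⁻ (resolve i b₁) g))
    (λ { (inj₁ w) → Any.++⁺ˡ (from (resolve-good b₁) w)
       ; (inj₂ w) → Any.++⁺ʳ (resolve i b₁) (from (resolve-good b₂) w) })
    where
    split : ∀ {N u r} → Any (Good N u r) (resolve i b₁) ⊎ Any (Good N u r) (resolve i b₂) →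
            WinsChoice N u (b₁ ∨ b₂) (r ℕ.+ i ℕ.* N)
    split (inj₁ g) = inj₁ (to (resolve-good b₁) g)
    split (inj₂ g) = inj₂ (to (resolve-good b₂) g)

  region? : ∀ z i σ → Dec (regionReading z i ⊩ʳ σ)
  region? z i = ⊩ʳ? (i ℕ.<?_) (λ c → (c ℕ.<? i) ⊎-dec ((c ℕ.≟ i) ×-dec (0 ℕ.<? z)))

  candidates : Σ → ℕ → Elt → Φ 1 → List (B⁺ (Q × Subset 1))
  candidates a z (q , i) σ with region? z i σ | δ q a σ
  ... | yes _ | just b = [ b ]
  ... | _     | _      = []

  -- `support` only provides the constraints to try; `δ` is looked up again at `q` and `a`. A
  -- constraint listed several times merely repeats a conjunct in `moves`.
  enabled : Σ → ℕ → Elt → List (B⁺ (Q × Subset 1))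
  enabled a z x = concatMap (λ (_ , _ , σ) → candidates a z x σ) support

  enabled⁻ : ∀ {a z q i b} → b ∈ enabled a z (q , i) →
             ∃[ σ ] (δ q a σ ≡ just b × regionReading z i ⊩ʳ σ)
  enabled⁻ {a} {z} {q} {i} {b} b∈ =
    let (_ , _ , σ) , c = Any.satisfied (∈-concatMap⁻ _ {xs = support} b∈) in σ , candidate σ c
    where
    candidate : ∀ σ → b ∈ candidates a z (q , i) σ → δ q a σ ≡ just b × regionReading z i ⊩ʳ σ
    candidate σ b∈ with region? z i σ | δ q a σ
    candidate σ (here refl) | yes s | just _ = refl , s

  enabled⁺ : ∀ {a z q i b σ} → δ q a σ ≡ just b → regionReading z i ⊩ʳ σ → b ∈ enabled a z (q , i)
  enabled⁺ {a} {z} {q} {i} {b} {σ} d s =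
    ∈-concatMap⁺ _ (lose (δ-finite q a σ (b , d)) (candidate d))
    where
    candidate : δ q a σ ≡ just b → b ∈ candidates a z (q , i) σ
    candidate d with region? z i σ | δ q a σ
    candidate d    | no ¬s | _      = ⊥-elim (¬s s)
    candidate refl | yes _ | just _ = here refl

  module _ (a : Σ) where

    moves : ℕ → Elt → List Outcome
    moves z x = combine (map (resolve (proj₂ x)) (enabled a z x))

    moveLetter : ℕ → Letter → List Outcome
    moveLetter z L = combine (map (moves z) L)

    moveWord : List Letter → List (List Elt × List Letter)
    moveWord []      = [ ([] , []) ]
    moveWord (L ∷ W) = cartesianProductWith (λ (R , S) (R′ , W′) → R ++ R′ , S ∷ W′)
                         (moveLetter 1 L) (moveWord W)

    -- A letter is read with delay 0, time having passed in separate steps. Elements of the zero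
    -- letter keep fractional part 0 whether reset or not, so both `R` and `S` go there, together
    -- with the resets `R′` of the other letters.
    post : Config → List Config
    post (L , W) = cartesianProductWith (λ (R , S) (R′ , W′) → R ++ S ++ R′ , W′)
                     (moveLetter 0 L) (moveWord W)

    module _ {N : ℕ} {u : GridWord} {r z : ℕ} (r<N : r ℕ.< N) (r⇔z : 0 ℕ.< r ⇔ 0 ℕ.< z) where

      moves-good : ∀ x → Any (Good N u r) (moves z x) ⇔ Won N ((a , 0) ∷ u) r x
      moves-good (q , i) = mk⇔
        (λ g {σ} {b} d s → to (resolve-good {r = r} b) (All.lookup
          (All.map⁻ (to (combine-good (map (resolve i) (enabled a z (q , i)))) g))
          (enabled⁺ d (to (reading σ) s))))
        (λ w → from (combine-good (map (resolve i) (enabled a z (q , i))))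
          (All.map⁺ (All.tabulate λ {b} b∈ → let σ , d , s = enabled⁻ b∈ in from (resolve-good {r = r} b) (w d (from (reading σ) s)))))
        where
        reading : ∀ σ → (gridReading N (r ℕ.+ i ℕ.* N) ⊩ʳ σ) ⇔ (regionReading z i ⊩ʳ σ)
        reading σ = ⊩ʳ-cong (grid-region r<N r⇔z) σ ℕ.≤-refl

      moveLetter-good : ∀ L → Any (Good N u r) (moveLetter z L) ⇔ All (Won N ((a , 0) ∷ u) r) L
      moveLetter-good L = mk⇔
        (λ g → All.map (to (moves-good _)) (All.map⁻ (to (combine-good (map (moves z) L)) g)))
        (λ w → from (combine-good (map (moves z) L)) (All.map⁺ (All.map (from (moves-good _)) w)))

-- Time steps and the decision on the grid

module Decision (A : ATA 1) where
  open ATA A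
  open OneClock A
  open Configs A

  private
    GoodWord : ℕ → GridWord → ℕ → Pred (List Elt × List Letter) 0ℓ
    GoodWord N u s (R , W) = All (Won N u 0) R × Placed (Won N u) N s W

    pos : ∀ {r} → 1 ℕ.≤ r → 0 ℕ.< r ⇔ 0 ℕ.< 1
    pos 1≤r = mk⇔ (λ _ → s≤s z≤n) (λ _ → 1≤r)

  module _ {a : Σ} {N : ℕ} {u : GridWord} where

    -- `moveWord` maps letters one to one, possibly to empty ones, so the same digits place both
    -- words.
    moveWord-complete : ∀ {s W} → 1 ℕ.≤ s → Placed (Won N ((a , 0) ∷ u)) N s W →
                        Any (GoodWord N u s) (moveWord a W)
    moveWord-complete 1≤s []                        = here ([] , [])
    moveWord-complete 1≤s (place r s≤r r<N ws rest) =
      Any.cartesianProductWith⁺ _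
        (λ { {_ , _} {_ , _} (wR , wS) (wR′ , pl) → All.++⁺ wR wR′ , place r s≤r r<N wS pl })
        (from (moveLetter-good a r<N (pos 1≤r) _) ws)
        (moveWord-complete (ℕ.m≤n⇒m≤1+n 1≤r) rest)
      where 1≤r = ℕ.≤-trans 1≤s s≤r

    moveWord-sound : ∀ {s} W → 1 ℕ.≤ s → ∀ {o} → o ∈ moveWord a W → GoodWord N u s o →
                     Placed (Won N ((a , 0) ∷ u)) N s W
    moveWord-sound []      1≤s o∈ good = []
    moveWord-sound (L ∷ W) 1≤s o∈ good
      with (R , S) , (R′ , W′) , o₁∈ , o₂∈ , refl ←
             ∈-cartesianProductWith⁻ _ (moveLetter a 1 L) (moveWord a W) o∈
      with wR , place r s≤r r<N wS pl ← good =
      place r s≤r r<N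
        (to (moveLetter-good a r<N (pos 1≤r) L) (lose o₁∈ (All.++⁻ˡ R wR , wS)))
        (moveWord-sound W (ℕ.m≤n⇒m≤1+n 1≤r) o₂∈ (All.++⁻ʳ R wR , pl))
      where 1≤r = ℕ.≤-trans 1≤s s≤r

    post-complete : ∀ {C} → 0 ℕ.< N → Fits N ((a , 0) ∷ u) C → Any (Fits N u) (post a C)
    post-complete 0<N (ws , pl) = Any.cartesianProductWith⁺ _
      (λ { {_ , _} {_ , _} (wR , wS) (wR′ , pl′) → All.++⁺ wR (All.++⁺ wS wR′) , pl′ })
      (from (moveLetter-good a 0<N (mk⇔ id id) _) ws)
      (moveWord-complete ℕ.≤-refl pl)

    post-sound : ∀ {C C′} → 0 ℕ.< N → C′ ∈ post a C → Fits N u C′ → Fits N ((a , 0) ∷ u) C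
    post-sound {L , W} 0<N C′∈ (ws , pl)
      with (R , S) , (R′ , W′) , o₁∈ , o₂∈ , refl ←
             ∈-cartesianProductWith⁻ _ (moveLetter a 0 L) (moveWord a W) C′∈ =
      to (moveLetter-good a 0<N (mk⇔ id id) L)
        (lose o₁∈ (All.++⁻ˡ R ws , All.++⁻ˡ S (All.++⁻ʳ R ws))) ,
      moveWord-sound W ℕ.≤-refl o₂∈ (All.++⁻ʳ S (All.++⁻ʳ R ws) , pl)

  -- Time elapses by so little that no fractional part wraps around, or until
  -- the largest fractional part reaches 1.
  tiny : Config → Config
  tiny (L , W) = [] , L ∷ W

  wrap : Config → List Config
  wrap (L , W) with initLast W
  ... | []       = []
  ... | W′ ∷ʳ′ L′ = [ (map next-integer L′ , L ∷ W′) ]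

  wrap⁺ : ∀ {L W} W′ L′ → W ≡ W′ List.∷ʳ L′ → (map next-integer L′ , L ∷ W′) ∈ wrap (L , W)
  wrap⁺ {W = W} W′ L′ eq with initLast W
  wrap⁺ []      L′ () | []
  wrap⁺ (_ ∷ _) L′ () | []
  wrap⁺ W′      L′ eq | W″ ∷ʳ′ L″ with refl , refl ← List.∷ʳ-injective W″ W′ eq = here refl

  wrap⁻ : ∀ L W {C} → C ∈ wrap (L , W) →
          ∃₂ λ W′ L′ → W ≡ W′ List.∷ʳ L′ × C ≡ (map next-integer L′ , L ∷ W′)
  wrap⁻ L W C∈ with initLast W
  wrap⁻ L _ (here refl) | W′ ∷ʳ′ L′ = W′ , L′ , refl , refl

  private
    won-tick : ∀ {N u r} x → Won N (shift 1 u) r x → Won N u (suc r) x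
    won-tick {N} {u} {r} x w =
      subst (λ r′ → Won N u r′ x) (ℕ.+-comm r 1) (to (won-shift {r = r} u x) w)

  -- All digits grow by one, and as they increase strictly along the word, only the last letter can
  -- reach `N`.
  tick : ∀ {N u s W} → Placed (Won N (shift 1 u)) N s W →
    Placed (Won N u) N (suc s) W ⊎
    ∃₂ λ W′ L → W ≡ W′ List.∷ʳ L × Placed (Won N u) N (suc s) W′ ×
                All (Won N u 0) (map next-integer L)
  tick [] = inj₁ []
  tick {N} {u} (place {L = L} r s≤r r<N ws rest) with suc r ℕ.<? N | rest
  ... | no 1+r≮N | [] = inj₂ ([] , L , refl , [] ,
        All.map⁺ (All.map (λ {x} → to (won-wrap r+1≡N u x)) ws))
    where
    r+1≡N : r ℕ.+ 1 ≡ N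
    r+1≡N = trans (ℕ.+-comm r 1) (ℕ.≤-antisym r<N (ℕ.≮⇒≥ 1+r≮N))
  ... | no 1+r≮N | place r′ r<r′ r′<N _ _ = ⊥-elim (1+r≮N (ℕ.≤-<-trans r<r′ r′<N))
  ... | yes 1+r<N | rest with tick rest
  ...   | inj₁ rest′ = inj₁ (place (suc r) (s≤s s≤r) 1+r<N
          (All.map (λ {x} → won-tick {r = r} x) ws) rest′)
  ...   | inj₂ (W′ , L′ , refl , rest′ , ws′) =
          inj₂ (L ∷ W′ , L′ , refl ,
                place (suc r) (s≤s s≤r) 1+r<N (All.map (λ {x} → won-tick {r = r} x) ws) rest′ , ws′)

  -- After one grid unit the former zero letter sits at digit 1, which has to be below `N`; hence
  -- `1 < N`.
  elapse-complete : ∀ {N u} C → 1 ℕ.< N → Fits N (shift 1 u) C →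
                    Any (Fits N u) (tiny C ∷ wrap C)
  elapse-complete {N} {u} (L , W) 1<N (ws , pl) with tick {u = u} pl
  ... | inj₁ pl′ = here ([] , place 1 ℕ.≤-refl 1<N (All.map (λ {x} → won-tick {r = 0} x) ws) pl′)
  ... | inj₂ (W′ , L′ , eq , pl′ , ws′) = there (lose (wrap⁺ {L} W′ L′ eq)
          (ws′ , place 1 ℕ.≤-refl 1<N (All.map (λ {x} → won-tick {r = 0} x) ws) pl′))

  private
    won-unshift : ∀ {N u d r} → d ℕ.≤ r → ∀ x → Won N u r x → Won N (shift d u) (r ℕ.∸ d) x
    won-unshift {N} {u} {d} {r} d≤r x w = from (won-shift {r = r ℕ.∸ d} u x)
      (subst (λ r′ → Won N u r′ x) (sym (ℕ.m∸n+n≡m d≤r)) w)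

    suc-∸ : ∀ {d r} → d ℕ.≤ r → suc (r ℕ.∸ d) ≡ suc r ℕ.∸ d
    suc-∸ d≤r = sym (ℕ.+-∸-assoc 1 d≤r)

  placed-shift : ∀ {N u d s W} → d ℕ.≤ s → Placed (Won N u) N s W →
                 Placed (Won N (shift d u)) N (s ℕ.∸ d) W
  placed-shift d≤s [] = []
  placed-shift {d = d} d≤s (place r s≤r r<N ws rest) =
    place (r ℕ.∸ d) (ℕ.∸-monoˡ-≤ d s≤r) (ℕ.≤-<-trans (ℕ.m∸n≤m r d) r<N)
      (All.map (λ {x} → won-unshift d≤r x) ws)
      (placed-weaken (ℕ.≤-reflexive (suc-∸ d≤r)) (placed-shift (ℕ.m≤n⇒m≤1+n d≤r) rest))
    where d≤r = ℕ.≤-trans d≤s s≤r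

  -- Before the delay `d` the wrapped letter had digit `N ∸ d`, which lies above the rewound digits
  -- of all other letters.
  placed-shift-wrap : ∀ {N u d s W L} → 0 ℕ.< d → d ℕ.≤ s → s ℕ.≤ N →
    Placed (Won N u) N s W → All (Won N u 0) (map next-integer L) →
    Placed (Won N (shift d u)) N (s ℕ.∸ d) (W List.∷ʳ L)
  placed-shift-wrap {N} {u} {d} 0<d d≤s s≤N [] ws =
    place (N ℕ.∸ d) (ℕ.∸-monoˡ-≤ d s≤N) (ℕ.∸-monoʳ-< 0<d (ℕ.≤-trans d≤s s≤N))
      (All.map (λ {x} → from (won-wrap (ℕ.m∸n+n≡m (ℕ.≤-trans d≤s s≤N)) u x)) (All.map⁻ ws)) []
  placed-shift-wrap {d = d} 0<d d≤s s≤N (place r s≤r r<N ws rest) ws′ =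
    place (r ℕ.∸ d) (ℕ.∸-monoˡ-≤ d s≤r) (ℕ.≤-<-trans (ℕ.m∸n≤m r d) r<N)
      (All.map (λ {x} → won-unshift d≤r x) ws)
      (placed-weaken (ℕ.≤-reflexive (suc-∸ d≤r))
        (placed-shift-wrap 0<d (ℕ.m≤n⇒m≤1+n d≤r) r<N rest ws′))
    where d≤r = ℕ.≤-trans d≤s s≤r

  -- In both kinds of step the former zero letter is the first one with positive digit in `C′`. That
  -- digit `d` is the delay: rewinding by it returns the letter to 0.
  elapse-sound : ∀ {N u} C {C′} → C′ ∈ tiny C ∷ wrap C → Fits N u C′ →
                 ∃[ d ] Fits N (shift d u) C
  elapse-sound {N} {u} (L , W) (here refl) (_ , place d 0<d d<N ws rest) =
    d , All.map (λ {x} → subst (λ r → Won N (shift d u) r x) (ℕ.n∸n≡0 d) ∘ won-unshift ℕ.≤-refl x) ws ,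
    placed-weaken (ℕ.≤-reflexive (sym (ℕ.m+n∸n≡m 1 d))) (placed-shift (ℕ.n≤1+n d) rest)
  elapse-sound {N} {u} (L , W) (there C′∈) fits
    with W′ , L′ , refl , refl ← wrap⁻ L W C′∈
    with ws′ , place d 0<d d<N ws rest ← fits =
    d , All.map (λ {x} → subst (λ r → Won N (shift d u) r x) (ℕ.n∸n≡0 d) ∘ won-unshift ℕ.≤-refl x) ws ,
    placed-weaken (ℕ.≤-reflexive (sym (ℕ.m+n∸n≡m 1 d))) (placed-shift-wrap 0<d (ℕ.n≤1+n d) d<N rest ws′)

  next : Config → List Config
  next C = (tiny C ∷ wrap C) ++ concatMap (λ a → post a C) (allFin #Σ)

  next-sound : ∀ {N u} C {C′} → 0 ℕ.< N → C′ ∈ next C → Fits N u C′ → ∃[ u′ ] Fits N u′ C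
  next-sound {N} {u} C 0<N C′∈ fits with ∈-++⁻ (tiny C ∷ wrap C) C′∈
  ... | inj₁ C′∈ = let d , fits′ = elapse-sound C C′∈ fits in shift d u , fits′
  ... | inj₂ C′∈ with a , C′∈post ← Any.satisfied (∈-concatMap⁻ (λ a → post a C) {xs = allFin #Σ} C′∈) =
        (a , 0) ∷ u , post-sound 0<N C′∈post fits

  Final : Pred Config 0ℓ
  Final (L , W) = All ((_∈ˢ F) ∘ proj₁) L × All (All ((_∈ˢ F) ∘ proj₁)) W

  final? : Unary.Decidable Final
  final? (L , W) = letter? L ×-dec All.all? letter? W
    where letter? = All.all? λ x → proj₁ x ∈? F

  open Search _≼?_ ≼-refl final? next

  placed-final : ∀ {s W} → All (All ((_∈ˢ F) ∘ proj₁)) W →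
                 ∀ {N} → s ℕ.+ length W ≡ N → Placed (Won N []) N s W
  placed-final []               eq = []
  placed-final {s} (final ∷ fs) {N} eq = place s ℕ.≤-refl
    (subst (s ℕ.<_) eq (ℕ.m<m+n s (s≤s z≤n))) final
    (placed-final fs (trans (sym (ℕ.+-suc s _)) eq))

  -- The final configuration determines the grid: `suc (length W)` leaves room for consecutive
  -- digits from 1 on. Going backwards changes the word only.
  leads⇒fits : ∀ {C} → Leads C → ∃₂ λ N u → 0 ℕ.< N × Fits N u C
  leads⇒fits {L , W} (stop (f , fs)) = suc (length W) , [] , s≤s z≤n , f , placed-final fs refl
  leads⇒fits {C}     (step leads)    =
    let N , u , 0<N , _ , C′∈ , fits = continue leads
        u′ , fits′ = next-sound C 0<N C′∈ fits
    in N , u′ , 0<N , fits′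
    where
    continue : ∀ {Cs} → Any Leads Cs → ∃₂ λ N u → 0 ℕ.< N × ∃[ C′ ] (C′ ∈ Cs × Fits N u C′)
    continue (here l) = let N , u , 0<N , fits = leads⇒fits l in N , u , 0<N , _ , here refl , fits
    continue (there ls) = let N , u , 0<N , C′ , C′∈ , fits = continue ls in
      N , u , 0<N , C′ , there C′∈ , fits

  module _ {Cs : List Config} (stuck : ∀ {C} → C ∈ Cs → Stuck Cs C) {N : ℕ} (1<N : 1 ℕ.< N) where

    private 0<N = ℕ.<-trans (s≤s z≤n) 1<N

    descend : ∀ {u C} → Covered Cs C → Fits N u C → ∃[ C′ ] (C′ ∈ Cs × Fits N u C′)
    descend covered fits with _ , C′∈ , C′≼C ← find covered =
      _ , C′∈ , fits-antitone 0<N C′≼C fits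

    -- Induction on the word and on the next delay in grid units. Each unit or letter leads to a
    -- successor, which is replaced by a member of `Cs` embedded in it. A delay `suc t` is by
    -- definition a `shift 1` of `t`.
    stuck⇒¬fits : ∀ u {C} → C ∈ Cs → ¬ Fits N u C
    read⇒¬fits  : ∀ a t u {C} → C ∈ Cs → ¬ Fits N ((a , t) ∷ u) C

    stuck⇒¬fits [] C∈ (ws , pl) = proj₁ (stuck C∈) (ws , all-final pl)
      where
      all-final : ∀ {s W} → Placed (Won N []) N s W → All (All ((_∈ˢ F) ∘ proj₁)) W
      all-final []                  = []
      all-final (place _ _ _ ws pl) = ws ∷ all-final pl
    stuck⇒¬fits ((a , t) ∷ u) C∈ fits = read⇒¬fits a t u C∈ fits

    read⇒¬fits a 0 u {C} C∈ fits
      with _ , C′∈ , fits′ ← find (post-complete 0<N fits)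
      with _ , C″∈ , fits″ ← descend (All.lookup (proj₂ (stuck C∈)) (∈-++⁺ʳ (tiny C ∷ wrap C)
             (∈-concatMap⁺ (λ a → post a C) (lose (∈-allFin a) C′∈)))) fits′ =
      stuck⇒¬fits u C″∈ fits″
    read⇒¬fits a (suc t) u {C} C∈ fits
      with _ , C′∈ , fits′ ← find (elapse-complete {u = (a , t) ∷ u} C 1<N fits)
      with _ , C″∈ , fits″ ← descend (All.lookup (proj₂ (stuck C∈)) (∈-++⁺ˡ C′∈)) fits′ =
      read⇒¬fits a t u C″∈ fits″

  grid-decision : (∃₂ λ N u → 0 ℕ.< N × Wins N u q₀ 0) ⊎
                  (∀ {N} → 1 ℕ.< N → ∀ u → ¬ Wins N u q₀ 0)
  grid-decision with search ≼-noetherian ([ q₀ , 0 ] , [])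
  ... | inj₁ leads with N , u , 0<N , (w ∷ [] , _) ← leads⇒fits leads = inj₁ (N , u , 0<N , w)
  ... | inj₂ (Cs , covered , stuck) =
        inj₂ λ 1<N u w → 
          let _ , C∈ , fits = descend stuck 1<N covered (w ∷ [] , [])
          in stuck⇒¬fits stuck 1<N u C∈ fits

-- Real numbers

fromℤ-+ : ∀ i j → fromℤ (i ℤ.+ j) ≡ fromℤ i ℚ.+ fromℤ j
fromℤ-+ i j = sym (trans (ℚ./-cong (cong₂ ℤ._+_ (ℤ.*-identityʳ i) (ℤ.*-identityʳ j)) refl)
                         (ℚ.↥p/↧p≡p (fromℤ (i ℤ.+ j))))

fromℤ-* : ∀ i j → fromℤ (i ℤ.* j) ≡ fromℤ i ℚ.* fromℤ j
fromℤ-* i j = sym (ℚ.↥p/↧p≡p (fromℤ (i ℤ.* j)))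

nat : ℕ → ℚ
nat n = fromℤ (+ n)

nat-+ : ∀ m n → nat (m ℕ.+ n) ≡ nat m ℚ.+ nat n
nat-+ m n = fromℤ-+ (+ m) (+ n)

nat-* : ∀ m n → nat (m ℕ.* n) ≡ nat m ℚ.* nat n
nat-* m n = trans (cong fromℤ (ℤ.pos-* m n)) (fromℤ-* (+ m) (+ n))

nat-mono-≤ : ∀ {m n} → m ℕ.≤ n → nat m ℚ.≤ nat n
nat-mono-≤ {m} {n} m≤n = *≤* (subst₂ ℤ._≤_ (sym (ℤ.*-identityʳ (+ m)))
  (sym (ℤ.*-identityʳ (+ n))) (ℤ.+≤+ m≤n))

nat-mono-< : ∀ {m n} → m ℕ.< n → nat m ℚ.< nat n
nat-mono-< {m} {n} m<n = *<* (subst₂ ℤ._<_ (sym (ℤ.*-identityʳ (+ m)))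
  (sym (ℤ.*-identityʳ (+ n))) (ℤ.+<+ m<n))

≤-nat : ∀ p → ∃[ n ] p ℚ.≤ nat n
≤-nat p@(ℚ.mkℚ i d _) = ℤ.∣ i ∣ , *≤* (ℤ.≤-trans (ℤ.≤-reflexive (ℤ.*-identityʳ i)) (scaled i))
  where
  scaled : ∀ i → i ℤ.≤ + ℤ.∣ i ∣ ℤ.* + suc d
  scaled (+ n)        = subst (+ n ℤ.≤_) (ℤ.pos-* n (suc d)) (ℤ.+≤+ (ℕ.m≤m*n n (suc d)))
  scaled (ℤ.-[1+ n ]) = ℤ.-≤+

-- For linear arithmetic: a ≤ b is a sum of hypotheses, and the equation is left to
-- the ring solver.
≤-from : ∀ {a b x y} → a ℚ.≤ b → x ℚ.+ b ≡ y ℚ.+ a → x ℚ.≤ y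
≤-from {a} {b} {x} {y} a≤b eq = subst₂ ℚ._≤_ (cancel x b) (cancel y b)
  (ℚ.+-monoˡ-≤ (ℚ.- b) (subst (ℚ._≤ y ℚ.+ b) (sym eq) (ℚ.+-monoʳ-≤ y a≤b)))
  where
  cancel : ∀ x b → x ℚ.+ b ℚ.+ ℚ.- b ≡ x
  cancel = solve 2 (λ x b → x :+ b :+ (:- b) := x) refl

<-irreflexive : ∀ {x} → ¬ (x < x)
<-irreflexive {x} (ε , ε>0 , N , p) = ℚ.<-irrefl refl (ℚ.<-≤-trans ε>0
  (≤-from (p N ℕ.≤-refl) (solve 2 (λ x e → e :+ x := con 0ℚ :+ (x :+ e)) refl (seq x N) ε)))

<-transitive : ∀ {x y z} → x < y → y < z → x < z
<-transitive {x} {y} {z} (ε , ε>0 , M , p) (η , η>0 , N , q) =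
  ε , ε>0 , M ℕ.⊔ N , λ n n≥ → ≤-from
    (ℚ.+-mono-≤ (p n (ℕ.m⊔n≤o⇒m≤o M N n≥))
      (ℚ.+-mono-≤ (q n (ℕ.m⊔n≤o⇒n≤o M N n≥)) (ℚ.<⇒≤ η>0)))
    (solve 5 (λ x y z e h → x :+ e :+ (y :+ (z :+ h)) := z :+ (x :+ e :+ (y :+ h :+ con 0ℚ))) refl
      (seq x n) (seq y n) (seq z n) ε η)

<-asymmetric : ∀ {x y} → x < y → ¬ (y < x)
<-asymmetric {x} {y} x<y y<x = <-irreflexive {x} (<-transitive {x} {y} {x} x<y y<x)

<-pointwise-≤ : ∀ {x y z} → (∀ n → seq y n ℚ.≤ seq z n) → x < y → x < z
<-pointwise-≤ y≤z (ε , ε>0 , N , p) = ε , ε>0 , N , λ n n≥N → ℚ.≤-trans (p n n≥N) (y≤z n)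

<-translate : ∀ {x y x′ y′} (s : ℕ → ℚ) → (∀ n → seq x n ℚ.+ s n ≡ seq x′ n) →
              (∀ n → seq y n ℚ.+ s n ≡ seq y′ n) → (x < y) ⇔ (x′ < y′)
<-translate {x} {y} s x+s y+s = mk⇔
  (λ (ε , ε>0 , N , p) → ε , ε>0 , N , λ n n≥N →
    subst₂ (λ a b → a ℚ.+ ε ℚ.≤ b) (x+s n) (y+s n) (≤-from (p n n≥N)
      (solve 4 (λ x y s e → x :+ s :+ e :+ y := y :+ s :+ (x :+ e)) refl
        (seq x n) (seq y n) (s n) ε)))
  (λ (ε , ε>0 , N , p) → ε , ε>0 , N , λ n n≥N →
    ≤-from (subst₂ (λ a b → a ℚ.+ ε ℚ.≤ b) (sym (x+s n)) (sym (y+s n)) (p n n≥N))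
      (solve 4 (λ x y s e → x :+ e :+ (y :+ s) := y :+ (x :+ s :+ e)) refl
        (seq x n) (seq y n) (s n) ε))

private
  p≤∣p∣ : ∀ p → p ℚ.≤ ∣ p ∣
  p≤∣p∣ p with ℚ.≤-total 0ℚ p
  ... | inj₁ 0≤p = ℚ.≤-reflexive (sym (ℚ.0≤p⇒∣p∣≡p 0≤p))
  ... | inj₂ p≤0 = ℚ.≤-trans p≤0 (ℚ.0≤∣p∣ p)

eventually-≤ : ∀ x ε → 0ℚ ℚ.< ε →
  ∃[ N ] (∀ m n → N ℕ.≤ m → N ℕ.≤ n → seq x m ℚ.≤ seq x n ℚ.+ ε)
eventually-≤ x ε ε>0 with N , p ← cauchy x ε ε>0 = N , λ m n m≥ n≥ → ≤-from
  (ℚ.≤-trans (p≤∣p∣ (seq x m ℚ.- seq x n)) (ℚ.<⇒≤ (p m n m≥ n≥)))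
  (solve 3 (λ a b e → a :+ e := b :+ e :+ (a :- b)) refl (seq x m) (seq x n) ε)

private
  sixth : ∀ ε → ε ≡ (let h = ε ℚ.* (+ 1 ℚ./ 6) in h ℚ.+ h ℚ.+ h ℚ.+ (h ℚ.+ h ℚ.+ h))
  sixth = solve 1 (λ e → let h = e :* con (+ 1 ℚ./ 6) in e := h :+ h :+ h :+ (h :+ h :+ h)) refl

  sixth-pos : ∀ {ε} → 0ℚ ℚ.< ε → 0ℚ ℚ.< ε ℚ.* (+ 1 ℚ./ 6)
  sixth-pos {ε} ε>0 = subst (ℚ._< ε ℚ.* (+ 1 ℚ./ 6)) (ℚ.*-zeroˡ (+ 1 ℚ./ 6))
    (ℚ.*-monoˡ-<-pos (+ 1 ℚ./ 6) ε>0)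

-- The rational `seq y M` is compared with the middle of the gap `6h`. Either way `3h` is left, of
-- which the oscillation of the two sequences involved costs `2h`.
apart-cotransitive : ∀ {x z} h → 0ℚ ℚ.< h → ∀ K →
  (∀ n → K ℕ.≤ n → seq x n ℚ.+ (h ℚ.+ h ℚ.+ h ℚ.+ (h ℚ.+ h ℚ.+ h)) ℚ.≤ seq z n) →
  ∀ y → x < y ⊎ y < z
apart-cotransitive {x} {z} h h>0 K p y = compare
  where
  Kx Ky Kz M : ℕ
  Kx = proj₁ (eventually-≤ x h h>0)
  Ky = proj₁ (eventually-≤ y h h>0)
  Kz = proj₁ (eventually-≤ z h h>0)
  M = Kx ℕ.⊔ Ky ℕ.⊔ (Kz ℕ.⊔ K)
  Kx≤M : Kx ℕ.≤ M
  Kx≤M = ℕ.≤-trans (ℕ.m≤m⊔n Kx Ky) (ℕ.m≤m⊔n _ _)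
  Ky≤M : Ky ℕ.≤ M
  Ky≤M = ℕ.≤-trans (ℕ.m≤n⊔m Kx Ky) (ℕ.m≤m⊔n _ _)
  Kz≤M : Kz ℕ.≤ M
  Kz≤M = ℕ.≤-trans (ℕ.m≤m⊔n Kz K) (ℕ.m≤n⊔m (Kx ℕ.⊔ Ky) _)
  K≤M : K ℕ.≤ M
  K≤M = ℕ.≤-trans (ℕ.m≤n⊔m Kz K) (ℕ.m≤n⊔m (Kx ℕ.⊔ Ky) _)
  compare : x < y ⊎ y < z
  compare with ℚ.≤-total (seq x M ℚ.+ (h ℚ.+ h ℚ.+ h)) (seq y M)
  ... | inj₁ x+3h≤y = inj₁ (h , h>0 , M , λ n n≥M → ≤-from
    (ℚ.+-mono-≤ (proj₂ (eventually-≤ x h h>0) n M (ℕ.≤-trans Kx≤M n≥M) Kx≤M)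
    (ℚ.+-mono-≤ x+3h≤y
                (proj₂ (eventually-≤ y h h>0) M n Ky≤M (ℕ.≤-trans Ky≤M n≥M))))
    (solve 5 (λ xₙ xₘ yₙ yₘ h →
        xₙ :+ h :+ (xₘ :+ h :+ (yₘ :+ (yₙ :+ h))) := yₙ :+ (xₙ :+ (xₘ :+ (h :+ h :+ h) :+ yₘ)))
      refl (seq x n) (seq x M) (seq y n) (seq y M) h))
  ... | inj₂ y≤x+3h = inj₂ (h , h>0 , M , λ n n≥M → ≤-from
    (ℚ.+-mono-≤ (proj₂ (eventually-≤ y h h>0) n M (ℕ.≤-trans Ky≤M n≥M) Ky≤M)
    (ℚ.+-mono-≤ y≤x+3h
    (ℚ.+-mono-≤ (p M K≤M)
                (proj₂ (eventually-≤ z h h>0) M n Kz≤M (ℕ.≤-trans Kz≤M n≥M)))))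
    (solve 6 (λ yₙ yₘ xₘ zₙ zₘ h →
        yₙ :+ h :+ (yₘ :+ h :+ (xₘ :+ (h :+ h :+ h) :+ (zₘ :+ (zₙ :+ h)))) :=
        zₙ :+ (yₙ :+ (yₘ :+ (xₘ :+ (h :+ h :+ h :+ (h :+ h :+ h)) :+ zₘ))))
      refl (seq y n) (seq y M) (seq x M) (seq z n) (seq z M) h))

<-cotransitive : ∀ {x z} → x < z → ∀ y → x < y ⊎ y < z
<-cotransitive {x} {z} (ε , ε>0 , K , p) =
  apart-cotransitive {x} {z} (ε ℚ.* (+ 1 ℚ./ 6)) (sixth-pos ε>0) K
  (λ n n≥K → subst (λ e → seq x n ℚ.+ e ℚ.≤ seq z n) (sixth ε) (p n n≥K))

archimedean : ∀ x → ∃[ B ] x < fromℕ B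
archimedean x = bounded ½ (ℚ.positive⁻¹ ½)
  where
  bounded : ∀ ε → 0ℚ ℚ.< ε → ∃[ B ] x < fromℕ B
  bounded ε ε>0 =
    let N , ev  = eventually-≤ x ε ε>0
        B , x≤B = ≤-nat (seq x N ℚ.+ ε ℚ.+ ε)
    in B , ε , ε>0 , N , λ n n≥N → ≤-from
         (ℚ.+-mono-≤ (ev n N n≥N ℕ.≤-refl) x≤B)
         (solve 4 (λ a b c e → a :+ e :+ (b :+ e :+ c) := c :+ (a :+ (b :+ e :+ e))) refl
           (seq x n) (seq x N) (nat B) ε)

const-< : ∀ {x y p q} → (∀ n → seq x n ≡ p) → (∀ n → seq y n ≡ q) → (x < y) ⇔ (p ℚ.< q)
const-< {p = p} {q} x≡p y≡q = mk⇔
  (λ (ε , ε>0 , N , le) → ℚ.<-≤-trans (subst (ℚ._< p ℚ.+ ε) (ℚ.+-identityʳ p) (ℚ.+-monoʳ-< p ε>0))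
    (subst₂ (λ a b → a ℚ.+ ε ℚ.≤ b) (x≡p N) (y≡q N) (le N ℕ.≤-refl)))
  (λ p<q → q ℚ.- p , subst (ℚ._< q ℚ.- p) (ℚ.+-inverseʳ p) (ℚ.+-monoˡ-< (ℚ.- p) p<q) , 0 , λ n _ →
    ℚ.≤-reflexive (trans (cong (ℚ._+ (q ℚ.- p)) (x≡p n))
      (trans (solve 2 (λ p q → p :+ (q :- p) := q) refl p q) (sym (y≡q n)))))

Offset : ℝ → ℕ → ℝ → Set
Offset x k y = ∀ n → seq x n ℚ.+ nat k ≡ seq y n

InUnit : ℝ → Set
InUnit x = fromℕ 0 ≤ x × x < fromℕ 1

-- `0 ≤ y` is only a negation and yields no rational bound. Comparing `y + w` with `x < w` by
-- cotransitivity leaves `x < y + w`, as the alternative `y + w < w` is refuted.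
offset-< : ∀ {x y i j X Y} w → x < fromℕ w → fromℕ 0 ≤ y → Offset x i X → Offset y j Y →
           w ℕ.+ i ℕ.≤ j → X < Y
offset-< {x} {y} {i} {j} {X} {Y} w x<w 0≤y X≐ Y≐ w+i≤j =
  [ (λ x<y+w → <-pointwise-≤ {X} {y + fromℕ w + fromℕ i} {Y} below
      (to (<-translate {x} {y + fromℕ w} {X} {y + fromℕ w + fromℕ i} (λ _ → nat i) X≐ (λ _ → refl)) x<y+w))
  , (λ y+w<w → ⊥-elim (0≤y (from (<-translate {y} {fromℕ 0} {y + fromℕ w} {fromℕ w}
      (λ _ → nat w) (λ _ → refl) (λ _ → ℚ.+-identityˡ (nat w))) y+w<w)))
  ]′ (<-cotransitive {x} {fromℕ w} x<w (y + fromℕ w))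
  where
  below : ∀ n → seq y n ℚ.+ nat w ℚ.+ nat i ℚ.≤ seq Y n
  below n = subst₂ ℚ._≤_
    (trans (cong (seq y n ℚ.+_) (nat-+ w i)) (sym (ℚ.+-assoc (seq y n) (nat w) (nat i))))
    (Y≐ n)
    (ℚ.+-monoʳ-≤ (seq y n) (nat-mono-≤ w+i≤j))

real-digits-< : ∀ {x y i j X Y} → InUnit x → InUnit y → Offset x i X → Offset y j Y →
                i ℕ.< j → X < Y
real-digits-< {x} {y} {i} {j} {X} {Y} (_ , x<1) (0≤y , _) X≐ Y≐ i<j =
  offset-< {x} {y} {i} {j} {X} {Y} 1 x<1 0≤y X≐ Y≐ i<j

-- The counterpart of `digits-lex`: both orders are lexicographic, so preserving the order of
-- fractional parts preserves all comparisons.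
real-digits : ∀ {x y i j X Y} → InUnit x → InUnit y → Offset x i X → Offset y j Y →
              (X < Y) ⇔ (i ℕ.< j ⊎ (i ≡ j × x < y))
real-digits {x} {y} {i} {j} {X} {Y} x∈ y∈ X≐ Y≐ = mk⇔ forth back
  where
  forth : X < Y → i ℕ.< j ⊎ (i ≡ j × x < y)
  forth X<Y with ℕ.<-cmp i j
  ... | tri< i<j _ _  = inj₁ i<j
  ... | tri≈ _ refl _ = inj₂ (refl , from (<-translate {x} {y} {X} {Y} (λ _ → nat i) X≐ Y≐) X<Y)
  ... | tri> _ _ j<i  = ⊥-elim (<-asymmetric {X} {Y} X<Y
          (real-digits-< {y} {x} {j} {i} {Y} {X} y∈ x∈ Y≐ X≐ j<i))
  back : i ℕ.< j ⊎ (i ≡ j × x < y) → X < Y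
  back (inj₁ i<j)          = real-digits-< {x} {y} {i} {j} {X} {Y} x∈ y∈ X≐ Y≐ i<j
  back (inj₂ (refl , x<y)) = to (<-translate {x} {y} {X} {Y} (λ _ → nat i) X≐ Y≐) x<y

-- Double-negation shift for a finite index set; it allows all floors and all comparisons of
-- fractional parts to be assumed at once.
¬¬-∀-Fin : ∀ n {P : Pred (Fin n) 0ℓ} → (∀ i → ¬ ¬ P i) → ¬ ¬ (∀ i → P i)
¬¬-∀-Fin zero    ¬¬P k = k λ ()
¬¬-∀-Fin (suc n) ¬¬P k = ¬¬P zero λ p → ¬¬-∀-Fin n (¬¬P ∘ suc) λ ps →
  k λ { zero → p ; (suc i) → ps i }

floor : ∀ B x → fromℕ 0 ≤ x → x < fromℕ B → ¬ ¬ (∃[ k ] fromℕ k ≤ x × x < fromℕ (suc k))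
floor zero    x 0≤x x<B ¬floor = 0≤x x<B
floor (suc B) x 0≤x x<B ¬floor = ¬¬-excluded-middle λ
  { (yes x<B′) → floor B x 0≤x x<B′ ¬floor
  ; (no  x≮B′) → ¬floor (B , x≮B′ , x<B) }

fractional : ∀ k x → fromℕ k ≤ x → x < fromℕ (suc k) → ∃[ y ] InUnit y × Offset y k x
fractional k x k≤x x<1+k = y , (k≤x ∘ from below , from above x<1+k) , y≐
  where
  y : ℝ
  y = x + fromℚ (ℚ.- nat k)
  y≐ : Offset y k x
  y≐ n = solve 2 (λ x k → x :+ (:- k) :+ k := x) refl (seq x n) (nat k)
  below : (x < fromℕ k) ⇔ (y < fromℕ 0)
  below = mk⇔ (from t) (to t)
    where t = <-translate {y} {fromℕ 0} {x} {fromℕ k} (λ _ → nat k) y≐ (λ _ → ℚ.+-identityˡ (nat k))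
  above : (y < fromℕ 1) ⇔ (x < fromℕ (suc k))
  above = <-translate {y} {fromℕ 1} {x} {fromℕ (suc k)} (λ _ → nat k) y≐ (λ _ → sym (nat-+ 1 k))

-- Ranks and discretization

count : ∀ {X : Set} {P : Pred X 0ℓ} → Unary.Decidable P → List X → ℕ
count P? xs = length (filter P? xs)

module _ {X : Set} {P Q : Pred X 0ℓ} (P? : Unary.Decidable P) (Q? : Unary.Decidable Q)
         (P⊆Q : ∀ {x} → P x → Q x) where

  count-≤ : ∀ xs → count P? xs ℕ.≤ count Q? xs
  count-≤ []       = z≤n
  count-≤ (x ∷ xs) with P? x | Q? x
  ... | yes p | yes q = s≤s (count-≤ xs)
  ... | yes p | no ¬q = ⊥-elim (¬q (P⊆Q p))
  ... | no ¬p | yes q = ℕ.m≤n⇒m≤1+n (count-≤ xs)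
  ... | no ¬p | no ¬q = count-≤ xs

  count-< : ∀ {z xs} → z ∈ xs → ¬ P z → Q z → count P? xs ℕ.< count Q? xs
  count-< {xs = x ∷ xs} z∈ ¬Pz Qz with P? x | Q? x | z∈
  ... | yes p | _     | here refl = ⊥-elim (¬Pz p)
  ... | no ¬p | no ¬q | here refl = ⊥-elim (¬q Qz)
  ... | no ¬p | yes q | here refl = s≤s (count-≤ xs)
  ... | yes p | yes q | there z∈′ = s≤s (count-< z∈′ ¬Pz Qz)
  ... | yes p | no ¬q | there _   = ⊥-elim (¬q (P⊆Q p))
  ... | no ¬p | yes q | there z∈′ = ℕ.m≤n⇒m≤1+n (count-< z∈′ ¬Pz Qz)
  ... | no ¬p | no ¬q | there z∈′ = count-< z∈′ ¬Pz Qz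

module Rank {n} {_≺_ : Rel (Fin n) 0ℓ} (_≺?_ : Decidable _≺_) (≺-irrefl : ∀ {i} → ¬ (i ≺ i))
  (≺-trans : Transitive _≺_) (≺-cotrans : ∀ {i j} → i ≺ j → ∀ k → i ≺ k ⊎ k ≺ j) where

  rank : Fin n → ℕ
  rank i = count (_≺? i) (allFin n)

  rank≤n : ∀ i → rank i ℕ.≤ n
  rank≤n i = subst (rank i ℕ.≤_) (List.length-tabulate id) (List.length-filter (_≺? i) (allFin n))

  -- Cotransitivity makes `_≺_` a strict weak order: if `i ≺ j` fails, everything below `j` is below
  -- `i`, so `rank j` cannot exceed `rank i`.
  rank-< : ∀ {i j} → (i ≺ j) ⇔ (rank i ℕ.< rank j)
  rank-< {i} {j} = mk⇔
    (λ i≺j → count-< (_≺? i) (_≺? j) (λ k≺i → ≺-trans k≺i i≺j) (∈-allFin i) ≺-irrefl i≺j) back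
    where
    back : rank i ℕ.< rank j → i ≺ j
    back lt with i ≺? j
    ... | yes i≺j = i≺j
    ... | no  i⊀j = ⊥-elim (ℕ.<⇒≱ lt (count-≤ (_≺? j) (_≺? i) lower (allFin n)))
      where
      lower : ∀ {k} → k ≺ j → k ≺ i
      lower k≺j with ≺-cotrans k≺j i
      ... | inj₁ k≺i = k≺i
      ... | inj₂ i≺j = ⊥-elim (i⊀j i≺j)

-- A clock last reset at time `T j` shows `T i - T j` at time `T i`. Adding `T j` to both sides of
-- its comparison with `c` avoids the subtraction.
record Discretization {n} (T : Fin n → ℝ₊) : Set where
  field
    N     : ℕ
    1<N   : 1 ℕ.< N
    τ     : Fin n → ℕ
    below : ∀ i j c → (real (T i) < real (T j) + fromℕ c) ⇔ (τ i ℕ.< τ j ℕ.+ c ℕ.* N)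
    above : ∀ i j c → (real (T j) + fromℕ c < real (T i)) ⇔ (τ j ℕ.+ c ℕ.* N ℕ.< τ i)

-- The fractional parts are replaced by their ranks.
discretize : ∀ {n} (T : Fin n → ℝ₊) → ¬ ¬ Discretization T
discretize {n} T ¬disc =
  ¬¬-∀-Fin n (λ i → let B , T<B = archimedean (real (T i)) in
    floor B (real (T i)) (nonneg (T i)) T<B) λ floors →
  let k = λ i → proj₁ (floors i)
      frac = λ i → fractional (k i) (real (T i)) (proj₁ (proj₂ (floors i))) (proj₂ (proj₂ (floors i)))
      x = λ i → proj₁ (frac i)
  in ¬¬-∀-Fin n (λ i → ¬¬-∀-Fin n λ j → ¬¬-excluded-middle {A = x i < x j}) λ x<?x →
  ¬disc (ranked k x (λ i → proj₁ (proj₂ (frac i))) (λ i → proj₂ (proj₂ (frac i))) x<?x)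
  where
  ranked : (k : Fin n → ℕ) (x : Fin n → ℝ) → (∀ i → InUnit (x i)) →
           (∀ i → Offset (x i) (k i) (real (T i))) → (∀ i j → Dec (x i < x j)) → Discretization T
  ranked k x x∈ x≐ x<?x = record
    { N     = N
    ; 1<N   = s≤s (s≤s z≤n)
    ; τ     = τ
    ; below = λ i j c → subst (λ m → (real (T i) < real (T j) + fromℕ c) ⇔ (τ i ℕ.< m)) (τ+ j c)
                          (digits i j (real (T i)) (real (T j) + fromℕ c) (x≐ i) (x+≐ j c))
    ; above = λ i j c → subst (λ m → (real (T j) + fromℕ c < real (T i)) ⇔ (m ℕ.< τ i)) (τ+ j c)
                          (digits j i (real (T j) + fromℕ c) (real (T i)) (x+≐ j c) (x≐ i))
    }
    where
    N : ℕ
    -- Ranks are at most `n`, so they are digits to base `2 + n`, which also exceeds 1 for every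
    -- `n`.
    N = 2 ℕ.+ n
    open Rank {_≺_ = λ i j → x i < x j} x<?x (λ {i} → <-irreflexive {x i})
      (λ {i} {j} {k} → <-transitive {x i} {x j} {x k})
      (λ {i} {j} lt k → <-cotransitive {x i} {x j} lt (x k))
    r<N : ∀ i → rank i ℕ.< N
    r<N i = s≤s (ℕ.m≤n⇒m≤1+n (rank≤n i))
    τ : Fin n → ℕ
    τ i = rank i ℕ.+ k i ℕ.* N
    τ+ : ∀ j c → rank j ℕ.+ (k j ℕ.+ c) ℕ.* N ≡ τ j ℕ.+ c ℕ.* N
    τ+ j c = trans (cong (rank j ℕ.+_) (ℕ.*-distribʳ-+ N (k j) c)) (sym (ℕ.+-assoc (rank j) _ _))
    x+≐ : ∀ j c → Offset (x j) (k j ℕ.+ c) (real (T j) + fromℕ c)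
    x+≐ j c m = trans (cong (seq (x j) m ℚ.+_) (nat-+ (k j) c))
      (trans (sym (ℚ.+-assoc (seq (x j) m) (nat (k j)) (nat c))) (cong (ℚ._+ nat c) (x≐ j m)))
    lex : ∀ {i j a b} → (a ℕ.< b ⊎ (a ≡ b × x i < x j)) ⇔ Lex (rank i) a (rank j) b
    lex = mk⇔ (λ { (inj₁ lt) → inj₁ lt ; (inj₂ (eq , lt)) → inj₂ (eq , to rank-< lt) })
              (λ { (inj₁ lt) → inj₁ lt ; (inj₂ (eq , lt)) → inj₂ (eq , from rank-< lt) })
    digits : ∀ i j X Y {a b} → Offset (x i) a X → Offset (x j) b Y →
             (X < Y) ⇔ (rank i ℕ.+ a ℕ.* N ℕ.< rank j ℕ.+ b ℕ.* N)
    digits i j X Y {a} {b} X≐ Y≐ = mk⇔ (from grid ∘ to lex ∘ to reals) (from reals ∘ from lex ∘ to grid)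
      where
      reals : (X < Y) ⇔ (a ℕ.< b ⊎ (a ≡ b × x i < x j))
      reals = real-digits {x i} {x j} {a} {b} {X} {Y} (x∈ i) (x∈ j) X≐ Y≐
      grid : (rank i ℕ.+ a ℕ.* N ℕ.< rank j ℕ.+ b ℕ.* N) ⇔ Lex (rank i) a (rank j) b
      grid = digits-lex (r<N i) (r<N j)

-- Real and discrete time

Matches : ℕ → ℝ → ℕ → Set
Matches N x n = ∀ c → ((x < fromℕ c) ⇔ (n ℕ.< c ℕ.* N)) × ((fromℕ c < x) ⇔ (c ℕ.* N ℕ.< n))

matches-⊨ : ∀ {N n v} → Matches N (real (v zero)) n → ∀ σ → (v ⊨ σ) ⇔ (gridReading N n ⊩ʳ σ)
matches-⊨ match (zero <ᶜ c) = proj₁ (match c)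
matches-⊨ match (zero ≤ᶜ c) = ¬-cong-⇔ (proj₂ (match c))
matches-⊨ match (σ ∧ᶜ τ)    = matches-⊨ match σ ×-⇔ matches-⊨ match τ
matches-⊨ match (¬ᶜ σ)      = ¬-cong-⇔ (matches-⊨ match σ)

module Rescaled (A : ATA 1) (M : ℕ) where
  open ATA A
  open OneClock A

  private
    N : ℕ
    N = suc M

    ratio : ℕ → ℚ
    ratio n = nat n ℚ.* ℚ.1/ nat N

    ratio-0 : ratio 0 ≡ nat 0
    ratio-0 = ℚ.*-zeroˡ (ℚ.1/ nat N)

    ratio-+ : ∀ m n → ratio (m ℕ.+ n) ≡ ratio m ℚ.+ ratio n
    ratio-+ m n = trans (cong (ℚ._* ℚ.1/ nat N) (nat-+ m n))
                        (ℚ.*-distribʳ-+ (ℚ.1/ nat N) (nat m) (nat n))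

    ratio-*N : ∀ c → ratio (c ℕ.* N) ≡ nat c
    ratio-*N c = trans (cong (ℚ._* ℚ.1/ nat N) (nat-* c N))
      (trans (ℚ.*-assoc (nat c) (nat N) (ℚ.1/ nat N))
      (trans (cong (nat c ℚ.*_) (ℚ.*-inverseʳ (nat N))) (ℚ.*-identityʳ (nat c))))

    ratio-mono-< : ∀ {m n} → m ℕ.< n → ratio m ℚ.< ratio n
    ratio-mono-< m<n = ℚ.*-monoˡ-<-pos (ℚ.1/ nat N) {{ℚ.1/pos⇒pos (nat N)}} (nat-mono-< m<n)

    ratio-cancel-< : ∀ {m n} → ratio m ℚ.< ratio n → m ℕ.< n
    ratio-cancel-< {m} {n} lt with ℕ.<-cmp m n
    ... | tri< m<n _ _  = m<n
    ... | tri≈ _ refl _ = ⊥-elim (ℚ.<-irrefl refl lt)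
    ... | tri> _ _ n<m  = ⊥-elim (ℚ.<-asym lt (ratio-mono-< n<m))

    ratio-≥0 : ∀ n → fromℕ 0 ≤ fromℚ (ratio n)
    ratio-≥0 n lt = ℕ.n≮0 (ratio-cancel-< {n} {0} (subst (ratio n ℚ.<_) (sym ratio-0)
      (to (const-< {fromℚ (ratio n)} {fromℕ 0} (λ _ → refl) (λ _ → refl)) lt)))

    delay : ℕ → ℝ₊
    delay t = mkℝ₊ (fromℚ (ratio t)) (ratio-≥0 t)

    matches : ∀ {x n} → (∀ k → seq x k ≡ ratio n) → Matches N x n
    matches {x} {n} x≡n c =
      mk⇔ (λ lt → ratio-cancel-< (to below lt)) (λ lt → from below (ratio-mono-< lt)) ,
      mk⇔ (λ lt → ratio-cancel-< (to above lt)) (λ lt → from above (ratio-mono-< lt))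
      where
      below : (x < fromℕ c) ⇔ (ratio n ℚ.< ratio (c ℕ.* N))
      below = const-< {x} {fromℕ c} x≡n (λ _ → sym (ratio-*N c))
      above : (fromℕ c < x) ⇔ (ratio (c ℕ.* N) ℚ.< ratio n)
      above = const-< {fromℕ c} {x} (λ _ → sym (ratio-*N c)) x≡n

    rescale : GridWord → TimedWord
    rescale = map λ (a , t) → a , delay t

    R : GridWord → ℕ → Valuation 1 → TimedWord → Set
    R u n v w = w ≡ rescale u × (∀ k → seq (real (v zero)) k ≡ ratio n)

    advance : ∀ {u n v w} → R u n v w → Advances A (gridModel N) (realModel 1) R u n v w
    advance {[]}                    (refl , _)   = tt
    advance {(a , t) ∷ u} {n} {v} (refl , v≡n) =
      refl , (λ {_} {σ} _ → to (matches-⊨ {v = v ⊕ delay t}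
        (matches {real (v zero +₊ delay t)} {t ℕ.+ n} v+t≡) σ)) , refl , v+t≡
      where
      v+t≡ : ∀ k → seq (real (v zero)) k ℚ.+ ratio t ≡ ratio (t ℕ.+ n)
      v+t≡ k = trans (cong (ℚ._+ ratio t) (v≡n k))
        (trans (ℚ.+-comm (ratio n) (ratio t)) (sym (ratio-+ t n)))

    resets : ∀ {u n v w} → R u n v w → ∀ r →
      R u (ClockModel.resetValue (gridModel N) n r) (v [ r :=0]) w
    resets {n = n} {v} (eq , v≡n) r = eq , reset-to (does (zero ∈? r))
      where
      reset-to : ∀ b k → seq (real (if b then 0₊ else v zero)) k ≡ ratio (if b then 0 else n)
      reset-to true  k = sym ratio-0
      reset-to false k = v≡n k

  grid⇒L : ∀ {u} → Wins N u q₀ 0 → ∃[ w ] L A w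
  grid⇒L {u} wins = rescale u , wins⇒L A
    (Simulation.simulate A (gridModel N) (realModel 1) R
      (λ {u} {n} {v} → advance {u} {n} {v}) (λ {u} {n} {v} → resets {u} {n} {v})
      (refl , λ _ → sym ratio-0) wins)

module Discretized (A : ATA 1) where
  open ATA A
  open OneClock A

  -- The starting time is included because the clock counts as reset there; every other reset
  -- happens at a reading time.
  time : ℝ₊ → (w : TimedWord) → Fin (suc (length w)) → ℝ₊
  time x w             zero    = x
  time x ((a , t) ∷ w) (suc i) = time (x +₊ t) w i

  module _ {n} {T : Fin n → ℝ₊} (D : Discretization T) where
    open Discretization D

    data Timeline : Fin n → TimedWord → GridWord → Set where
      []   : ∀ {i} → Timeline i [] []
      tick : ∀ {a t t′ i j w u} →
             (∀ k → seq (real (T i)) k ℚ.+ seq (real t) k ≡ seq (real (T j)) k) →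
             t′ ℕ.+ τ i ≡ τ j → Timeline j w u → Timeline i ((a , t) ∷ w) ((a , t′) ∷ u)

    private
      τ-mono : ∀ {i j t} → (∀ k → seq (real (T i)) k ℚ.+ seq (real t) k ≡ seq (real (T j)) k) →
               τ i ℕ.≤ τ j
      τ-mono {i} {j} {t} Ti+t≡Tj = ℕ.≮⇒≥ λ τj<τi → nonneg t
        (from (<-translate {real t} {fromℕ 0} {real (T j)} {real (T i) + fromℕ 0} (seq (real (T i)))
                (λ k → trans (ℚ.+-comm (seq (real t) k) (seq (real (T i)) k)) (Ti+t≡Tj k))
                (λ k → ℚ.+-comm (nat 0) (seq (real (T i)) k)))
          (from (below j i 0) (subst (τ j ℕ.<_) (sym (ℕ.+-identityʳ (τ i))) τj<τi)))

    -- One discretization serves all suffixes of the word; `e` locates the times of the current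
    -- suffix among those of the whole.
    timeline : ∀ w x (e : Fin (suc (length w)) → Fin n) → (∀ j → T (e j) ≡ time x w j) →
               ∃[ u ] Timeline (e zero) w u
    timeline []            x e T≡ = [] , []
    timeline ((a , t) ∷ w) x e T≡ =
      let u , line = timeline w (x +₊ t) (e ∘ suc) (T≡ ∘ suc) in
      (a , τ (e (suc zero)) ℕ.∸ τ (e zero)) ∷ u , tick later (ℕ.m∸n+n≡m (τ-mono {t = t} later)) line
      where
      later : ∀ k → seq (real (T (e zero))) k ℚ.+ seq (real t) k ≡ seq (real (T (e (suc zero)))) k
      later k = trans (cong (λ y → seq (real y) k ℚ.+ seq (real t) k) (T≡ zero))
                      (cong (λ y → seq (real y) k) (sym (T≡ (suc zero))))

    private
      -- i is the present and s the time of the last reset.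
      Elapsed : Fin n → Fin n → ℝ₊ → ℕ → Set
      Elapsed i s v m =
        (∀ k → seq (real v) k ℚ.+ seq (real (T s)) k ≡ seq (real (T i)) k) × m ℕ.+ τ s ≡ τ i

      matches : ∀ {i s v m} → Elapsed i s v m → Matches N (real v) m
      matches {i} {s} {v} {m} (v+Ts , m+τs) c =
        mk⇔ (λ lt → ℕ.+-cancelʳ-< (τ s) m (c ℕ.* N)
              (subst₂ ℕ._<_ (sym m+τs) (ℕ.+-comm (τ s) _) (to (below i s c) (to v<c lt))))
            (λ lt → from v<c (from (below i s c)
              (subst₂ ℕ._<_ m+τs (ℕ.+-comm _ (τ s)) (ℕ.+-monoˡ-< (τ s) lt)))) ,
        mk⇔ (λ lt → ℕ.+-cancelʳ-< (τ s) (c ℕ.* N) m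
              (subst₂ ℕ._<_ (ℕ.+-comm (τ s) _) (sym m+τs) (to (above i s c) (to c<v lt))))
            (λ lt → from c<v (from (above i s c)
              (subst₂ ℕ._<_ (ℕ.+-comm _ (τ s)) m+τs (ℕ.+-monoˡ-< (τ s) lt))))
        where
        c+Ts : ∀ k → nat c ℚ.+ seq (real (T s)) k ≡ seq (real (T s)) k ℚ.+ nat c
        c+Ts k = ℚ.+-comm (nat c) (seq (real (T s)) k)
        v<c : (real v < fromℕ c) ⇔ (real (T i) < real (T s) + fromℕ c)
        v<c = <-translate {real v} {fromℕ c} {real (T i)} {real (T s) + fromℕ c}
                (seq (real (T s))) v+Ts c+Ts
        c<v : (fromℕ c < real v) ⇔ (real (T s) + fromℕ c < real (T i))
        c<v = <-translate {fromℕ c} {real v} {real (T s) + fromℕ c} {real (T i)}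
                (seq (real (T s))) c+Ts v+Ts

      R : TimedWord → Valuation 1 → ℕ → GridWord → Set
      R w v m u = ∃₂ λ i s → Timeline i w u × Elapsed i s (v zero) m

      advance : ∀ {w v m u} → R w v m u → Advances A (realModel 1) (gridModel N) R w v m u
      advance (i , s , [] , _) = tt
      advance {v = v} {m} (i , s , tick {t = t} {t′} {j = j} Ti+t t′+τi line , v+Ts , m+τs) =
        refl , (λ {_} {σ} _ → from (matches-⊨ {v = v ⊕ t} (matches {v = v zero +₊ t} elapsed) σ)) ,
        j , s , line , elapsed
        where
        elapsed : Elapsed j s (v zero +₊ t) (t′ ℕ.+ m)
        elapsed =
          (λ k → trans (rearrange (seq (real (v zero)) k) (seq (real t) k) (seq (real (T s)) k))
            (trans (cong (ℚ._+ seq (real t) k) (v+Ts k)) (Ti+t k))) ,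
          trans (ℕ.+-assoc t′ m (τ s)) (trans (cong (t′ ℕ.+_) m+τs) t′+τi)
          where
          rearrange : ∀ x t s → x ℚ.+ t ℚ.+ s ≡ x ℚ.+ s ℚ.+ t
          rearrange = solve 3 (λ x t s → x :+ t :+ s := x :+ s :+ t) refl

      resets : ∀ {w v m u} → R w v m u → ∀ r →
        R w (v [ r :=0]) (ClockModel.resetValue (gridModel N) m r) u
      resets {v = v} {m} (i , s , line , elapsed) r =
        let s′ , elapsed′ = reset-to (does (zero ∈? r)) in i , s′ , line , elapsed′
        where
        reset-to : ∀ b → ∃[ s′ ] Elapsed i s′ (if b then 0₊ else v zero) (if b then 0 else m)
        reset-to true  = i , (λ k → ℚ.+-identityˡ (seq (real (T i)) k)) , refl
        reset-to false = s , elapsed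

    discretized-wins : ∀ {i w u} → Timeline i w u →
      EveWins.Wins A (realModel 1) w q₀ 𝟎 → Wins N u q₀ 0
    discretized-wins {i} line = Simulation.simulate A (realModel 1) (gridModel N) R
      (λ {w} {v} {m} → advance {w} {v} {m}) (λ {w} {v} {m} → resets {w} {v} {m})
      (i , i , line , (λ k → ℚ.+-identityˡ (seq (real (T i)) k)) , refl)

  L⇒grid : ∀ {w} → L A w → ¬ ¬ (∃₂ λ N u → 1 ℕ.< N × Wins N u q₀ 0)
  L⇒grid {w} accepted ¬grid = discretize (time 0₊ w) λ D →
    let u , line = timeline D w 0₊ id (λ _ → refl)
    in ¬grid (Discretization.N D , u , Discretization.1<N D ,
              discretized-wins D line (L⇒wins A accepted))

theorem2 : (A : ATA 1) → Dec (Empty (L A))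
theorem2 A with Decision.grid-decision A
... | inj₂ ¬wins = yes λ w accepted → Discretized.L⇒grid A accepted
        λ (_ , u , 1<N , wins) → ¬wins 1<N u wins
... | inj₁ (suc M , u , _ , wins) = no λ empty →
        let w , accepted = Rescaled.grid⇒L A M wins in empty w accepted
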